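{- Let $A$ be a finite set with $q:=|A|\ge 2$ and let $n\ge 2$. For $2\le l\le n$ let $G_l$ be the subgroup of $\mathrm{Sym}(A^n)$ generated by all $l$-ary instructions. Then: (i) for any $n$, $G_n=\mathrm{Sym}(A^n)$; (ii) if $q=2$ (identifying $A$ with $\mathrm{GF}(2)$), then $G_2=\mathrm{Aff}(n,2)$ for all $n$, and $G_3=G_{n-1}=\mathrm{Alt}(A^n)$ for $n\ge 4$; (iii) if $n\ge 3$ and $q\ge 3$ is odd, then $G_2=G_{n-1}=\mathrm{Sym}(A^n)$; (iv) if $n\ge 3$ and $q\ge 4$ is even, then $G_2=G_{n-1}=\mathrm{Alt}(A^n)$.
   Context: Any $f\in\mathrm{Sym}(A^n)$ is written $f(x)=(f_1(x),\ldots,f_n(x))$ with coordinate functions $f_i:A^n\to A$; the $i$-th coordinate function is trivial if $f_i(x)=x_i$ for all $x$. An instruction is a permutation of $A^n$ with at most one nontrivial coordinate function (the identity counts as an instruction). A coordinate function $f_j$ is $l$-ary if it depends on at most $l$ of the variables, i.e. $f_j(x)=h(x_{k_1},\ldots,x_{k_l})$ for some $k_1,\ldots,k_l\in\{1,\ldots,n\}$ and some $h:A^l\to A$; an $l$-ary instruction is an instruction whose coordinate functions are all $l$-ary. $\mathrm{Aff}(n,2)$ denotes the affine group of $\mathrm{GF}(2)^n$ (maps $x\mapsto Mx+b$ with $M\in\mathrm{GL}(n,2)$, $b\in\mathrm{GF}(2)^n$). -}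

module Defs where

open import Algebra.Bundles using (Group; CommutativeRing)
open import Data.Bool.Base using (Bool; _∧_; _xor_)
open import Data.Bool.Properties using (xor-∧-commutativeRing)
open import Data.Fin.Base using (Fin)
open import Data.Fin.Properties using (_≟_)
open import Data.List.Base using (List; foldr; length)
open import Data.List.Relation.Unary.All using (All)
open import Data.Nat.Base using (ℕ)
open import Data.Nat.Divisibility using (_∣_)
open import Data.Product.Base using (Σ-syntax; ∃-syntax; _×_; _,_)
open import Data.Vec.Base using (Vec; lookup; map)
open import Function.Bundles using (_↔_; Inverse)
open import Function.Properties.Inverse using (↔-refl; ↔-sym; ↔-trans)
open import Level using (Level; 0ℓ; _⊔_)
open import Relation.Binary.PropositionalEquality using (_≡_; _≢_; refl; sym; trans; cong)
open import Relation.Nullary.Decidable.Core using (does)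
open import Relation.Nullary.Negation.Core using (¬_)
open import Relation.Unary using (Pred)

open import Algebra.Properties.Monoid.Sum (CommutativeRing.+-monoid xor-∧-commutativeRing) using (sum)

open Inverse using (to; from; strictlyInverseˡ; strictlyInverseʳ)

private
  variable
    a c ℓ p : Level

-- Permutations are compared by their action on points, and
-- (f ∙ g) x = f (g x).
Sym : Set a → Group a a
Sym X = record
  { Carrier = X ↔ X
  ; _≈_     = λ f g → ∀ x → to f x ≡ to g x
  ; _∙_     = λ f g → ↔-trans g f
  ; ε       = ↔-refl
  ; _⁻¹     = ↔-sym
  ; isGroup = record
    { isMonoid = record
      { isSemigroup = record
        { isMagma = record
          { isEquivalence = record
            { refl  = λ _ → refl
            ; sym   = λ f≈g x → sym (f≈g x)
            ; trans = λ f≈g g≈h x → trans (f≈g x) (g≈h x)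
            }
          ; ∙-cong = λ {f} {g} {h} {k} f≈g h≈k x →
              trans (cong (to f) (h≈k x)) (f≈g (to k x))
          }
        ; assoc = λ _ _ _ _ → refl
        }
      ; identity = (λ _ _ → refl) , (λ _ _ → refl)
      }
    ; inverse = strictlyInverseʳ , strictlyInverseˡ
    ; ⁻¹-cong = λ {f} {g} f≈g x →
        trans (cong (from f) (sym (strictlyInverseˡ g x)))
        (trans (cong (from f) (sym (f≈g (from g x))))
               (strictlyInverseʳ f (from g x)))
    }
  }

Perm : Set a → Set a
Perm X = Group.Carrier (Sym X)

module _ (𝔾 : Group c ℓ) where
  open Group 𝔾 using (Carrier; _≈_; _∙_; ε; _⁻¹)

  data Generated (S : Pred Carrier p) : Pred Carrier (c ⊔ ℓ ⊔ p) where
    gen  : ∀ {g} → S g → Generated S g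
    unit : Generated S ε
    mul  : ∀ {g h} → Generated S g → Generated S h → Generated S (g ∙ h)
    inv  : ∀ {g} → Generated S g → Generated S (g ⁻¹)
    resp : ∀ {g h} → g ≈ h → Generated S g → Generated S h

module _ {X : Set a} where
  open Group (Sym X) using (_≈_; _∙_; ε)

  IsTransposition : Pred (Perm X) a
  IsTransposition f = ∃[ u ] ∃[ v ] u ≢ v × to f u ≡ v × to f v ≡ u
                      × (∀ x → x ≢ u → x ≢ v → to f x ≡ x)

  -- For finite X: the even permutations, i.e. the products of an even
  -- number of transpositions.
  Alt : Pred (Perm X) a
  Alt f = Σ[ ts ∈ List (Perm X) ]
            All IsTransposition ts × 2 ∣ length ts × f ≈ foldr _∙_ ε ts

module _ {A : Set a} {n : ℕ} where

  coord : Perm (Vec A n) → Fin n → Vec A n → A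
  coord f i x = lookup (to f x) i

  Trivial : Perm (Vec A n) → Fin n → Set a
  Trivial f i = ∀ x → coord f i x ≡ lookup x i

  IsInstruction : Pred (Perm (Vec A n)) a
  IsInstruction f = ∀ i j → ¬ Trivial f i → ¬ Trivial f j → i ≡ j

  IsAry : ℕ → Pred (Vec A n → A) a
  IsAry l g = Σ[ ks ∈ Vec (Fin n) l ] Σ[ h ∈ (Vec A l → A) ]
                (∀ x → g x ≡ h (map (lookup x) ks))

  IsAryInstruction : ℕ → Pred (Perm (Vec A n)) a
  IsAryInstruction l f = IsInstruction f × (∀ j → IsAry l (coord f j))

G : (A : Set a) (n l : ℕ) → Pred (Perm (Vec A n)) a
G A n l = Generated (Sym (Vec A n)) (IsAryInstruction l)

-- GF(2) is Bool with _xor_ as addition and _∧_ as multiplication;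
-- accordingly, sum is iterated _xor_.
Matrix : ℕ → Set
Matrix n = Fin n → Fin n → Bool

identity : ∀ {n} → Matrix n
identity i j = does (i ≟ j)

_⊠_ : ∀ {n} → Matrix n → Matrix n → Matrix n
(M ⊠ N) i k = sum (λ j → M i j ∧ N j k)

_▹_ : ∀ {n} → Matrix n → (Fin n → Bool) → (Fin n → Bool)
(M ▹ x) i = sum (λ j → M i j ∧ x j)

GL : ∀ {n} → Pred (Matrix n) 0ℓ
GL {n} M = Σ[ N ∈ Matrix n ] (∀ i j → (M ⊠ N) i j ≡ identity i j)
                           × (∀ i j → (N ⊠ M) i j ≡ identity i j)

-- The affine group, transported to permutations of Aⁿ along an
-- identification φ of A with GF(2).
Aff : {A : Set a} → A ↔ Bool → (n : ℕ) → Pred (Perm (Vec A n)) a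
Aff φ n f = Σ[ M ∈ Matrix n ] Σ[ b ∈ (Fin n → Bool) ] GL M ×
  (∀ x i → to φ (coord f i x) ≡ (M ▹ (λ j → to φ (lookup x j))) i xor b i)

{-# OPTIONS --safe #-}
module Submission where

-- For a subgroup H and a fixed permutation t, "the transposition
-- (u v) lies in the coset H t" is a transitive relation in u, v, because
-- (u w) = (u v)(v w)(u v).  So H contains all transpositions (t = 1), or at
-- least Alt, as soon as the pairs u, v for which this holds connect the
-- points.  For t = 1 the pairs at Hamming distance one give (i).
--
-- Alt ⊆ G_l goes by induction on n, from G_l = Sym for n = l.  Write points of
-- Aⁿ⁺¹ as (x, y, s).  Let σ ∈ Alt(Aⁿ) act on (x, s) and τ ∈ Alt(Aⁿ) on (y, s),
-- both being 3-cycles chosen so that their supports in Aⁿ⁺¹ share one point;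
-- then [σ, τ] is a 3-cycle.  This needs three different values of s, whence
-- l = 2 for q ≥ 3 and l = 3 for q = 2.
--
-- An (n-1)-ary instruction ignores some coordinate that it also fixes, so it is
-- a product of q parallel copies of a permutation of Aⁿ⁻¹: an even permutation
-- if q is even, while for odd q the copies of a transposition are odd and
-- enlarge Alt to Sym.
--
-- For q = 2, affine maps are the solutions of F(x+y+z) = F(x)+F(y)+F(z); binary
-- instructions satisfy this, and Gaussian elimination by binary instructions
-- reduces every affine permutation to the identity.

open import Defs
open import Algebra.Bundles using (CommutativeRing; Group)
open import Data.Bool.Base using (Bool; true; false; _∧_; _xor_)
open import Data.Bool.Properties using (xor-∧-commutativeRing; xor-assoc; xor-comm; xor-same; xor-identityˡ; xor-identityʳ; ∧-zeroʳ; ∧-identityʳ) renaming (_≟_ to _≟ᵇ_)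
open import Data.Bool.Solver using (module xor-∧-Solver)
open import Data.Fin.Base using (Fin; zero; suc; punchIn; punchOut)
open import Data.Fin.Properties using (any?; all?; ¬∀⟶∃¬; pigeonhole; punchInᵢ≢i; punchIn-punchOut; <-irrefl) renaming (_≟_ to _≟ᶠ_)
open import Data.List.Base as List using (List; []; _∷_; _++_; foldr; length; cartesianProductWith)
open import Data.List.Membership.Propositional using (_∈_; _∉_)
open import Data.List.Membership.Propositional.Properties using (∈-cartesianProductWith⁺; ∈-map⁺; ∈-allFin)
open import Data.List.Properties using (length-++; length-map; length-tabulate)
open import Data.List.Relation.Unary.All as All using (All; []; _∷_)
open import Data.List.Relation.Unary.All.Properties using (++⁺)
open import Data.List.Relation.Unary.Any using (here; there)
open import Data.List.Relation.Unary.Unique.Propositional using (Unique; []; _∷_)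
open import Data.List.Relation.Unary.Unique.Propositional.Properties using (Unique[x∷xs]⇒x∉xs; map⁺; allFin⁺)
open import Data.Nat.Base using (ℕ; zero; suc; _+_; _∸_; _≤_; _≤′_; ≤′-refl; ≤′-step; s≤s)
open import Data.Nat.Divisibility using (_∣_; _∣0; ∣-refl; ∣m∣n⇒∣m+n; ∣m+n∣m⇒∣n; ∣1⇒≡1)
open import Data.Nat.Properties using (≤⇒≤′; ≤-trans; n≤1+n; n<1+n; +-comm)
open import Data.Product.Base using (∃-syntax; Σ-syntax; _×_; _,_; proj₁; proj₂)
open import Data.Sum.Base using (_⊎_; inj₁; inj₂)
open import Data.Vec.Base using (Vec; []; _∷_; lookup; map; head; tail; insertAt; removeAt; allFin; replicate; zipWith; _[_]≔_)
open import Data.Vec.Properties using (≡-dec; ∷-injectiveˡ; ∷-injectiveʳ; map-lookup-allFin; insertAt-lookup; insertAt-punchIn; removeAt-insertAt; insertAt-removeAt; tabulate∘lookup; tabulate-cong; map-id; map-∘; map-cong; lookup∘update′; lookup-zipWith; lookup-map; lookup-replicate; zipWith-assoc; zipWith-identityˡ)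
open import Function.Base using (_∘_)
open import Function.Bundles using (_↔_; Inverse; mk↔ₛ′)
open import Function.Properties.Inverse using (↔-sym; ↔⇒↣)
open import Level using (Level)
open import Relation.Binary.Definitions using (DecidableEquality)
open import Relation.Binary.PropositionalEquality using (_≡_; _≢_; refl; sym; trans; cong; cong₂; subst; ≢-sym; module ≡-Reasoning)
open import Relation.Nullary.Decidable using (Dec; yes; no; ¬?; map′; decidable-stable; via-injection)
open import Relation.Nullary.Negation.Core using (¬_; contradiction)
open import Relation.Unary using (Pred; _⊆_; U; _≐_)

open import Algebra.Properties.Monoid.Sum (CommutativeRing.+-monoid xor-∧-commutativeRing) using (sum; sum-cong-≗)

open Inverse using (to; from; strictlyInverseˡ; strictlyInverseʳ)

private
  variable
    a b p : Level
    A X : Set a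
    m n l : ℕ

-- Permutations as products, and the closure of `Alt` under them.

module _ {X : Set a} where
  open Group (Sym X) public using (_∙_; ε; _⁻¹; _≈_)

product : List (Perm X) → Perm X
product = foldr _∙_ ε

to-injective : (f : Perm X) → ∀ {x y} → to f x ≡ to f y → x ≡ y
to-injective f {x} {y} e =
  trans (sym (strictlyInverseʳ f x)) (trans (cong (from f) e) (strictlyInverseʳ f y))

fixed-from : (f : Perm X) → ∀ {x} → to f x ≡ x → from f x ≡ x
fixed-from f {x} e = trans (cong (from f) (sym e)) (strictlyInverseʳ f x)

product-++ : (fs gs : List (Perm X)) → product (fs ++ gs) ≈ product fs ∙ product gs
product-++ []       gs x = refl
product-++ (f ∷ fs) gs x = cong (to f) (product-++ fs gs x)

Alt-unit : Alt {X = X} ε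
Alt-unit = [] , [] , 2 ∣0 , λ _ → refl

Alt-mul : {f g : Perm X} → Alt f → Alt g → Alt (f ∙ g)
Alt-mul {f = f} (fs , tfs , 2∣fs , f≈) (gs , tgs , 2∣gs , g≈) =
  fs ++ gs , ++⁺ tfs tgs , subst (2 ∣_) (sym (length-++ fs)) (∣m∣n⇒∣m+n 2∣fs 2∣gs) ,
  λ x → trans (trans (cong (to f) (g≈ x)) (f≈ _)) (sym (product-++ fs gs x))

Alt-resp : {f g : Perm X} → f ≈ g → Alt f → Alt g
Alt-resp f≈g (fs , tfs , 2∣fs , f≈) = fs , tfs , 2∣fs , λ x → trans (sym (f≈g x)) (f≈ x)

∉-∷ : {x c : X} {L : List X} → x ≢ c → x ∉ L → x ∉ c ∷ L
∉-∷ x≢c x∉L (here x≡c)  = x≢c x≡c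
∉-∷ x≢c x∉L (there x∈L) = x∉L x∈L

-- Transpositions, 3-cycles as commutators, decomposition into transpositions.

module Transposition {X : Set a} (_≟_ : DecidableEquality X) where

  swap-to : X → X → X → X
  swap-to u v x with x ≟ u
  ... | yes _ = v
  ... | no  _ with x ≟ v
  ...   | yes _ = u
  ...   | no  _ = x

  swapˡ : ∀ u v → swap-to u v u ≡ v
  swapˡ u v with u ≟ u
  ... | yes _   = refl
  ... | no  u≢u = contradiction refl u≢u

  swapʳ : ∀ u v → swap-to u v v ≡ u
  swapʳ u v with v ≟ u
  ... | yes v≡u = v≡u
  ... | no  _ with v ≟ v
  ...   | yes _   = refl
  ...   | no  v≢v = contradiction refl v≢v

  swap-fix : ∀ {u v x} → x ≢ u → x ≢ v → swap-to u v x ≡ x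
  swap-fix {u} {v} {x} x≢u x≢v with x ≟ u
  ... | yes x≡u = contradiction x≡u x≢u
  ... | no  _ with x ≟ v
  ...   | yes x≡v = contradiction x≡v x≢v
  ...   | no  _   = refl

  locate : ∀ u v x → x ≡ u ⊎ x ≡ v ⊎ (x ≢ u × x ≢ v)
  locate u v x with x ≟ u | x ≟ v
  ... | yes x≡u | _       = inj₁ x≡u
  ... | no  _   | yes x≡v = inj₂ (inj₁ x≡v)
  ... | no  x≢u | no  x≢v = inj₂ (inj₂ (x≢u , x≢v))

  swap-involutive : ∀ u v x → swap-to u v (swap-to u v x) ≡ x
  swap-involutive u v x with locate u v x
  ... | inj₁ refl               = trans (cong (swap-to u v) (swapˡ u v)) (swapʳ u v)
  ... | inj₂ (inj₁ refl)        = trans (cong (swap-to u v) (swapʳ u v)) (swapˡ u v)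
  ... | inj₂ (inj₂ (x≢u , x≢v)) =
    trans (cong (swap-to u v) (swap-fix x≢u x≢v)) (swap-fix x≢u x≢v)

  swap : X → X → Perm X
  swap u v = mk↔ₛ′ (swap-to u v) (swap-to u v) (swap-involutive u v) (swap-involutive u v)

  swap-comm : ∀ u v x → swap-to u v x ≡ swap-to v u x
  swap-comm u v x with locate u v x
  ... | inj₁ refl               = trans (swapˡ u v) (sym (swapʳ v u))
  ... | inj₂ (inj₁ refl)        = trans (swapʳ u v) (sym (swapˡ v u))
  ... | inj₂ (inj₂ (x≢u , x≢v)) = trans (swap-fix x≢u x≢v) (sym (swap-fix x≢v x≢u))

  swap-unique : (f : Perm X) → ∀ {u v} → to f u ≡ v → to f v ≡ u →
                (∀ x → x ≢ u → x ≢ v → to f x ≡ x) → f ≈ swap u v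
  swap-unique f {u} {v} fu fv fix x with locate u v x
  ... | inj₁ refl               = trans fu (sym (swapˡ u v))
  ... | inj₂ (inj₁ refl)        = trans fv (sym (swapʳ u v))
  ... | inj₂ (inj₂ (x≢u , x≢v)) = trans (fix x x≢u x≢v) (sym (swap-fix x≢u x≢v))

  transposition-self-inverse : (f : Perm X) → IsTransposition f → f ⁻¹ ≈ f
  transposition-self-inverse f (u , v , _ , fu , fv , fix) x =
    trans (cong (from f) (sym ff)) (strictlyInverseʳ f (to f x))
    where
    f≈ : f ≈ swap u v
    f≈ = swap-unique f fu fv fix
    ff : to f (to f x) ≡ x
    ff = trans (f≈ _) (trans (cong (swap-to u v) (f≈ x)) (swap-involutive u v x))

  swap-isTransposition : ∀ {u v} → u ≢ v → IsTransposition (swap u v)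
  swap-isTransposition {u} {v} u≢v =
    u , v , u≢v , swapˡ u v , swapʳ u v , λ _ → swap-fix

  swap-Alt : ∀ {u v w z} → u ≢ v → w ≢ z → Alt (swap u v ∙ swap w z)
  swap-Alt u≢v w≢z =
    swap _ _ ∷ swap _ _ ∷ [] , swap-isTransposition u≢v ∷ swap-isTransposition w≢z ∷ [] ,
    ∣-refl , λ _ → refl

  swap-conj : ∀ {u v w} → u ≢ v → v ≢ w → u ≢ w →
              swap u v ∙ (swap v w ∙ swap u v) ≈ swap u w
  swap-conj {u} {v} {w} u≢v v≢w u≢w = swap-unique (swap u v ∙ (swap v w ∙ swap u v)) u↦w w↦u fix
    where
    u↦w : swap-to u v (swap-to v w (swap-to u v u)) ≡ w
    u↦w rewrite swapˡ u v | swapˡ v w = swap-fix (≢-sym u≢w) (≢-sym v≢w)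
    w↦u : swap-to u v (swap-to v w (swap-to u v w)) ≡ u
    w↦u rewrite swap-fix {u} {v} {w} (≢-sym u≢w) (≢-sym v≢w) | swapʳ v w = swapʳ u v
    fix : ∀ x → x ≢ u → x ≢ w → swap-to u v (swap-to v w (swap-to u v x)) ≡ x
    fix x x≢u x≢w with x ≟ v
    ... | yes refl rewrite swapʳ u v | swap-fix {v} {w} {u} u≢v u≢w = swapˡ u v
    ... | no  x≢v  rewrite swap-fix {u} {v} {x} x≢u x≢v | swap-fix {v} {w} {x} x≢v x≢w =
      swap-fix x≢u x≢v

  -- Since `p` is the only point moved by both, `τ` fixes `σ p` and `σ` fixes `τ p`, and the
  -- commutator runs through `p`, `σ p`, `τ p` in this order. Writing the 3-cycle as two swaps
  -- through `p` exhibits it as a quotient of transpositions, the form in which cosets are compared.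
  commutator-3-cycle : (σ τ : Perm X) → ∀ {p} → to σ p ≢ p → to τ p ≢ p →
    (∀ x → x ≢ p → to σ x ≡ x ⊎ to τ x ≡ x) →
    (σ ∙ τ) ∙ (σ ⁻¹ ∙ τ ⁻¹) ≈ swap p (to τ p) ∙ swap p (to σ p)
  commutator-3-cycle σ τ {p} σp≢p τp≢p disj = eq
    where
    α β : X
    α = to σ p
    β = to τ p

    σ-fixes : ∀ {x} → to τ x ≢ x → x ≢ p → to σ x ≡ x
    σ-fixes {x} τx≢x x≢p with disj x x≢p
    ... | inj₁ e = e
    ... | inj₂ e = contradiction e τx≢x

    τ-fixes : ∀ {x} → to σ x ≢ x → x ≢ p → to τ x ≡ x
    τ-fixes {x} σx≢x x≢p with disj x x≢p
    ... | inj₁ e = contradiction e σx≢x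
    ... | inj₂ e = e

    moved : (f : Perm X) → ∀ {x} → to f x ≢ x → to f (to f x) ≢ to f x
    moved f fx≢x e = fx≢x (to-injective f e)

    moved⁻ : (f : Perm X) → ∀ {x} → to f x ≢ x → to f (from f x) ≢ from f x
    moved⁻ f {x} fx≢x e =
      fx≢x (trans (cong (to f) (trans (sym (strictlyInverseˡ f x)) e)) (strictlyInverseˡ f x))

    from≢ : (f : Perm X) → ∀ {x y} → x ≢ to f y → from f x ≢ y
    from≢ f {x} x≢ e = x≢ (trans (sym (strictlyInverseˡ f x)) (cong (to f) e))

    τα : to τ α ≡ α
    τα = τ-fixes (moved σ σp≢p) σp≢p

    σβ : to σ β ≡ β
    σβ = σ-fixes (moved τ τp≢p) τp≢p

    α≢β : α ≢ β
    α≢β e = moved σ σp≢p (trans (cong (to σ) e) (trans σβ (sym e)))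

    C : Perm X
    C = (σ ∙ τ) ∙ (σ ⁻¹ ∙ τ ⁻¹)

    atα : to C α ≡ β
    atα rewrite fixed-from τ τα | strictlyInverseʳ σ p = σβ

    atβ : to C β ≡ p
    atβ rewrite strictlyInverseʳ τ p
              | τ-fixes (moved⁻ σ σp≢p) (from≢ σ (≢-sym σp≢p)) = strictlyInverseˡ σ p

    atp : to C p ≡ α
    atp rewrite fixed-from σ (σ-fixes (moved⁻ τ τp≢p) (from≢ τ (≢-sym τp≢p)))
              | strictlyInverseˡ τ p = refl

    -- If `τ` moves `x`, then `τ` also moves the preimage of `x` under `τ`, which is not `p` because
    -- `x ≢ β`; so `σ` fixes that preimage. The same holds with `σ`, `α` in place of `τ`, `β`.
    else : ∀ x → x ≢ p → x ≢ α → x ≢ β → to C x ≡ x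
    else x x≢p x≢α x≢β with to τ x ≟ x
    ... | no τx≢x
      rewrite fixed-from σ (σ-fixes (moved⁻ τ τx≢x) (from≢ τ x≢β))
            | strictlyInverseˡ τ x = σ-fixes τx≢x x≢p
    ... | yes τx≡x rewrite fixed-from τ τx≡x with to σ x ≟ x
    ...   | yes σx≡x rewrite fixed-from σ σx≡x | τx≡x = σx≡x
    ...   | no  σx≢x rewrite τ-fixes (moved⁻ σ σx≢x) (from≢ σ x≢α) = strictlyInverseˡ σ x

    eq : ∀ x → to C x ≡ swap-to p β (swap-to p α x)
    eq x with locate p α x
    ... | inj₁ refl        = trans atp (sym (trans (cong (swap-to p β) (swapˡ p α)) (swap-fix σp≢p α≢β)))
    ... | inj₂ (inj₁ refl) = trans atα (sym (trans (cong (swap-to p β) (swapʳ p α)) (swapˡ p β)))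
    ... | inj₂ (inj₂ (x≢p , x≢α)) with x ≟ β
    ...   | yes refl = trans atβ (sym (trans (cong (swap-to p β) (swap-fix x≢p x≢α)) (swapʳ p β)))
    ...   | no  x≢β  = trans (else x x≢p x≢α x≢β)
      (sym (trans (cong (swap-to p β) (swap-fix x≢p x≢α)) (swap-fix x≢p x≢β)))

  -- The list bounds the support. Following `f` by the swap of `to f c` and `c` turns `c` into a
  -- fixed point and moves no point outside `c ∷ L`, so the bound shrinks to `L`.
  decompose-on : (L : List X) (f : Perm X) → (∀ x → x ∉ L → to f x ≡ x) →
                 Σ[ ts ∈ List (Perm X) ] All IsTransposition ts × f ≈ product ts
  decompose-on [] f fix = [] , [] , λ x → fix x λ ()
  decompose-on (c ∷ L) f fix with to f c ≟ c
  ... | yes fc≡c = decompose-on L f fix′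
    where
    fix′ : ∀ x → x ∉ L → to f x ≡ x
    fix′ x x∉L with x ≟ c
    ... | yes refl = fc≡c
    ... | no  x≢c  = fix x (∉-∷ x≢c x∉L)
  ... | no fc≢c with decompose-on L (swap (to f c) c ∙ f) fix′
    where
    fix′ : ∀ x → x ∉ L → swap-to (to f c) c (to f x) ≡ x
    fix′ x x∉L with x ≟ c
    ... | yes refl = swapˡ (to f c) c
    ... | no  x≢c
      rewrite fix x (∉-∷ x≢c x∉L) =
      swap-fix (λ x≡fc → x≢c (to-injective f
                 (trans (fix x (∉-∷ x≢c x∉L)) x≡fc)))
               x≢c
  ... | ts , tts , g≈ = swap (to f c) c ∷ ts , swap-isTransposition fc≢c ∷ tts ,
    λ x → trans (sym (swap-involutive (to f c) c (to f x))) (cong (swap-to (to f c) c) (g≈ x))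

  decompose : (L : List X) → (∀ x → x ∈ L) → (f : Perm X) →
              Σ[ ts ∈ List (Perm X) ] All IsTransposition ts × f ≈ product ts
  decompose L complete f = decompose-on L f λ x x∉L → contradiction (complete x) x∉L

  -- Transpositions in a common coset of a generated subgroup.

  module Cosets (S : Pred (Perm X) p) where

    H : Pred (Perm X) _
    H = Generated (Sym X) S

    infix 4 _≋_
    -- Equality of the right cosets H f and H g.
    _≋_ : Perm X → Perm X → Set _
    f ≋ g = H (f ∙ g ⁻¹)

    ≋-sym : ∀ f g → f ≋ g → g ≋ f
    ≋-sym f g f≋g = resp (λ _ → refl) (inv f≋g)

    ≋-trans : ∀ f g h → f ≋ g → g ≋ h → f ≋ h
    ≋-trans f g h f≋g g≋h =
      resp (λ x → cong (to f) (strictlyInverseʳ g (from h x))) (mul f≋g g≋h)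

    ≋-respˡ : ∀ f f′ g → f ≈ f′ → f ≋ g → f′ ≋ g
    ≋-respˡ f f′ g f≈f′ = resp (λ x → f≈f′ _)

    module _ (t : Perm X) where

      -- The premise `u ≢ v` makes the diagonal hold vacuously: `swap u u` is the identity, which
      -- need not lie in the coset of `t`.
      SwapIn : X → X → Set _
      SwapIn u v = u ≢ v → swap u v ≋ t

      -- The middle factor of (u v)(v w)(u v) is its own inverse, so the product has the form a b⁻¹
      -- c with a, b, c in H t, and a b⁻¹ c t⁻¹ = (a t⁻¹)(b t⁻¹)⁻¹(c t⁻¹).
      SwapIn-trans : ∀ {u v w} → SwapIn u v → SwapIn v w → SwapIn u w
      SwapIn-trans {u} {v} {w} uv vw u≢w with u ≟ v | v ≟ w
      ... | yes refl | _        = vw u≢w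
      ... | no  _    | yes refl = uv u≢w
      ... | no  u≢v  | no v≢w   =
        resp (λ x → trans (cong (swap-to u v) (strictlyInverseʳ t _)) (swap-conj u≢v v≢w u≢w (from t x)))
             (mul (uv u≢v) (mul (≋-sym (swap v w) t (vw v≢w)) (uv u≢v)))

      transposition-≋ : (∀ u v → SwapIn u v) → ∀ f → IsTransposition f → f ≋ t
      transposition-≋ all f (u , v , u≢v , fu , fv , fix) =
        ≋-respˡ (swap u v) f t (λ x → sym (swap-unique f fu fv fix x)) (all u v u≢v)

      -- Two transpositions of one coset have their quotient f g⁻¹ = f g in H, and an even product
      -- splits into such pairs.
      all-SwapIn⇒Alt⊆ : (∀ u v → SwapIn u v) → ∀ {f} → Alt f → H f
      all-SwapIn⇒Alt⊆ all (ts , tts , 2∣ts , f≈) = resp (λ x → sym (f≈ x)) (even ts tts 2∣ts)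
        where
        even : ∀ ts → All IsTransposition ts → 2 ∣ length ts → H (product ts)
        even []       []          _   = unit
        even (_ ∷ []) _           2∣1 with () ← ∣1⇒≡1 2∣1
        even (f ∷ g ∷ ts) (tf ∷ tg ∷ tts) 2∣2+n =
          resp (λ x → cong (to f) (transposition-self-inverse g tg _))
            (mul (≋-trans f t g (transposition-≋ all f tf) (≋-sym g t (transposition-≋ all g tg)))
                 (even ts tts (∣m+n∣m⇒∣n 2∣2+n ∣-refl)))

    product∈ : (∀ f → IsTransposition f → H f) → ∀ {ts} → All IsTransposition ts → H (product ts)
    product∈ tr []                 = unit
    product∈ tr {f ∷ ts} (tf ∷ tts) = mul (tr f tf) (product∈ tr tts)

-- Spare values, parity, and vectors with one coordinate singled out.

HasOther : Set a → Set a
HasOther X = (c : X) → ∃[ d ] d ≢ c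

HasThird : Set a → Set a
HasThird X = (r s : X) → ∃[ t ] t ≢ r × t ≢ s

even-or-odd : ∀ n → 2 ∣ n ⊎ 2 ∣ suc n
even-or-odd zero    = inj₁ (2 ∣0)
even-or-odd (suc n) with even-or-odd n
... | inj₁ 2∣n  = inj₂ (∣m∣n⇒∣m+n ∣-refl 2∣n)
... | inj₂ 2∣sn = inj₁ 2∣sn

lookup-ext : {x y : Vec A n} → (∀ i → lookup x i ≡ lookup y i) → x ≡ y
lookup-ext {x = x} {y} eq =
  trans (sym (tabulate∘lookup x)) (trans (tabulate-cong eq) (tabulate∘lookup y))

map-cong-on : {f g : X → A} (ks : Vec X l) →
              (∀ i → f (lookup ks i) ≡ g (lookup ks i)) → map f ks ≡ map g ks
map-cong-on []       eq = refl
map-cong-on (k ∷ ks) eq = cong₂ _∷_ (eq zero) (map-cong-on ks (eq ∘ suc))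

data PunchView (k : Fin (suc n)) : Fin (suc n) → Set where
  here  : PunchView k k
  punch : ∀ i → PunchView k (punchIn k i)

punchView : (k j : Fin (suc n)) → PunchView k j
punchView k j with k ≟ᶠ j
... | yes refl = here
... | no  k≢j  = subst (PunchView k) (punchIn-punchOut k≢j) (punch (punchOut k≢j))

lookup-removeAt : (x : Vec A (suc n)) (k : Fin (suc n)) (i : Fin n) →
                  lookup (removeAt x k) i ≡ lookup x (punchIn k i)
lookup-removeAt x k i =
  trans (sym (insertAt-punchIn (removeAt x k) k (lookup x k) i))
        (cong (λ z → lookup z (punchIn k i)) (insertAt-removeAt x k))

insertAt-injectiveˡ : (k : Fin (suc n)) {c d : A} {x y : Vec A n} →
                      insertAt x k c ≡ insertAt y k d → x ≡ y
insertAt-injectiveˡ k {c} {d} {x} {y} e =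
  trans (sym (removeAt-insertAt x k c)) (trans (cong (λ z → removeAt z k) e) (removeAt-insertAt y k d))

insertAt-injectiveʳ : (k : Fin (suc n)) {c d : A} {x y : Vec A n} →
                      insertAt x k c ≡ insertAt y k d → c ≡ d
insertAt-injectiveʳ k {c} {d} {x} {y} e =
  trans (sym (insertAt-lookup x k c)) (trans (cong (λ z → lookup z k) e) (insertAt-lookup y k d))

-- Monotonicity in the arity, and the embedding into one more dimension.

generated-mono : {S T : Pred (Perm X) p} → S ⊆ T → Generated (Sym X) S ⊆ Generated (Sym X) T
generated-mono S⊆T (gen s)     = gen (S⊆T s)
generated-mono S⊆T unit        = unit
generated-mono S⊆T (mul f g)   = mul (generated-mono S⊆T f) (generated-mono S⊆T g)
generated-mono S⊆T (inv f)     = inv (generated-mono S⊆T f)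
generated-mono S⊆T (resp eq f) = resp eq (generated-mono S⊆T f)

module _ {A : Set a} where

  trivial-off⇒instruction : (f : Perm (Vec A n)) (j : Fin n) →
    (∀ i → i ≢ j → Trivial f i) → IsInstruction f
  trivial-off⇒instruction f j off i i′ ¬i ¬i′ with i ≟ᶠ j | i′ ≟ᶠ j
  ... | yes refl | yes refl = refl
  ... | no i≢j   | _        = contradiction (off i i≢j) ¬i
  ... | _        | no i′≢j  = contradiction (off i′ i′≢j) ¬i′

  all-ary : (g : Vec A n → A) → IsAry n g
  all-ary g = allFin _ , g , λ x → cong g (sym (map-lookup-allFin x))

  ary-suc : (g : Vec A (suc n) → A) → IsAry l g → IsAry (suc l) g
  ary-suc g (ks , h , g≗) = zero ∷ ks , h ∘ tail , g≗

  G-mono : l ≤′ m → G A (suc n) l ⊆ G A (suc n) m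
  G-mono ≤′-refl       g = g
  G-mono (≤′-step l≤m) g =
    generated-mono (λ { {f} (ins , ary) → ins , λ j → ary-suc (coord f j) (ary j) }) (G-mono l≤m g)

  -- Coordinate `k` is kept, and `f` acts in the same way on each layer where that coordinate is
  -- constant.
  emb : Fin (suc n) → Perm (Vec A n) → Perm (Vec A (suc n))
  emb k f = mk↔ₛ′ (act (to f)) (act (from f))
                  (inverse (to f) (from f) (strictlyInverseˡ f))
                  (inverse (from f) (to f) (strictlyInverseʳ f))
    where
    act : (Vec A _ → Vec A _) → Vec A (suc _) → Vec A (suc _)
    act g x = insertAt (g (removeAt x k)) k (lookup x k)
    inverse : ∀ g h → (∀ x → g (h x) ≡ x) → ∀ x → act g (act h x) ≡ x
    inverse g h gh x
      rewrite removeAt-insertAt (h (removeAt x k)) k (lookup x k)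
            | insertAt-lookup (h (removeAt x k)) k (lookup x k)
            | gh (removeAt x k) = insertAt-removeAt x k

  emb-insertAt : (k : Fin (suc n)) (f : Perm (Vec A n)) → ∀ x c →
                 to (emb k f) (insertAt x k c) ≡ insertAt (to f x) k c
  emb-insertAt k f x c =
    cong₂ (λ y d → insertAt (to f y) k d) (removeAt-insertAt x k c) (insertAt-lookup x k c)

  emb-unit : (k : Fin (suc n)) → ε ≈ emb k ε
  emb-unit k x = sym (insertAt-removeAt x k)

  emb-mul : (k : Fin (suc n)) (f g : Perm (Vec A n)) → emb k f ∙ emb k g ≈ emb k (f ∙ g)
  emb-mul k f g x = emb-insertAt k f (to g (removeAt x k)) (lookup x k)

  emb-cong : (k : Fin (suc n)) {f g : Perm (Vec A n)} → f ≈ g → emb k f ≈ emb k g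
  emb-cong k f≈g x = cong (λ y → insertAt y k (lookup x k)) (f≈g (removeAt x k))

  emb-here : (k : Fin (suc n)) (f : Perm (Vec A n)) → Trivial (emb k f) k
  emb-here k f x = insertAt-lookup (to f (removeAt x k)) k (lookup x k)

  emb-punch : (k : Fin (suc n)) (f : Perm (Vec A n)) (i : Fin n) →
              ∀ x → coord (emb k f) (punchIn k i) x ≡ coord f i (removeAt x k)
  emb-punch k f i x = insertAt-punchIn (to f (removeAt x k)) k (lookup x k) i

  emb-trivial : (k : Fin (suc n)) (f : Perm (Vec A n)) (i : Fin n) →
                Trivial f i → Trivial (emb k f) (punchIn k i)
  emb-trivial k f i triv x = trans (emb-punch k f i x) (trans (triv _) (lookup-removeAt x k i))

  emb-instruction : (k : Fin (suc n)) (f : Perm (Vec A n)) →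
                    IsAryInstruction (suc l) f → IsAryInstruction (suc l) (emb k f)
  emb-instruction k f (ins , ary) = ins′ , ary′
    where
    ins′ : IsInstruction (emb k f)
    ins′ j j′ ¬j ¬j′ with punchView k j | punchView k j′
    ... | here    | _        = contradiction (emb-here k f) ¬j
    ... | _       | here     = contradiction (emb-here k f) ¬j′
    ... | punch i | punch i′ = cong (punchIn k)
      (ins i i′ (¬j ∘ emb-trivial k f i) (¬j′ ∘ emb-trivial k f i′))
    ary′ : ∀ j → IsAry _ (coord (emb k f) j)
    ary′ j with punchView k j
    -- The kept coordinate still reads one variable, its own; hence the arity `suc l`.
    ... | here    = replicate _ k , head , emb-here k f
    ... | punch i with ks , h , eq ← ary i =
      map (punchIn k) ks , h , λ x → trans (emb-punch k f i x) (trans (eq _) (cong h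
        (trans (map-cong (lookup-removeAt x k) ks) (map-∘ (lookup x) (punchIn k) ks))))

  emb-G : (k : Fin (suc n)) {f : Perm (Vec A n)} → G A n (suc l) f → G A (suc n) (suc l) (emb k f)
  emb-G k {f} (gen s)                = gen (emb-instruction k f s)
  emb-G k unit                       = resp (emb-unit k) unit
  emb-G k (mul {f} {g} Gf Gg)        = resp (emb-mul k f g) (mul (emb-G k Gf) (emb-G k Gg))
  emb-G k (inv Gf)                   = resp (λ _ → refl) (inv (emb-G k Gf))
  emb-G k (resp {f} {g} f≈g Gf)      = resp (emb-cong k {f} {g} f≈g) (emb-G k Gf)

  -- Enumeration of Aⁿ and generation by transpositions at Hamming distance one.

  allVecs : List A → ∀ n → List (Vec A n)
  allVecs L zero    = [] ∷ []
  allVecs L (suc n) = cartesianProductWith _∷_ L (allVecs L n)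

  allVecs-complete : (L : List A) → (∀ c → c ∈ L) → (x : Vec A n) → x ∈ allVecs L n
  allVecs-complete L full []      = here refl
  allVecs-complete L full (c ∷ x) = ∈-cartesianProductWith⁺ _∷_ (full c) (allVecs-complete L full x)

  -- One vector is turned into the other by updating its coordinates from left to right.
  update-connected : (R : Vec A n → Vec A n → Set b) → (∀ {x y z} → R x y → R y z → R x z) →
                     (∀ x → R x x) → (∀ x i c → R x (x [ i ]≔ c)) → ∀ x y → R x y
  update-connected R R-trans R-refl R-upd []      []      = R-refl []
  update-connected R R-trans R-refl R-upd (c ∷ x) (d ∷ y) =
    R-trans (R-upd (c ∷ x) zero d)
      (update-connected (λ x y → R (d ∷ x) (d ∷ y)) R-trans (λ x → R-refl (d ∷ x))
        (λ x i → R-upd (d ∷ x) (suc i)) x y)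

  module _ (_≟_ : DecidableEquality A) where

    _≟ⱽ_ : DecidableEquality (Vec A n)
    _≟ⱽ_ = ≡-dec _≟_

    private
      module T {n : ℕ} = Transposition (_≟ⱽ_ {n})
    open T

    swap-update-instruction : (x : Vec A n) (i : Fin n) (c : A) →
                              IsAryInstruction n (swap x (x [ i ]≔ c))
    swap-update-instruction x i c =
      trivial-off⇒instruction f i off , λ j → all-ary (coord f j)
      where
      f = swap x (x [ i ]≔ c)
      off : ∀ j → j ≢ i → Trivial f j
      off j j≢i z with locate x (x [ i ]≔ c) z
      ... | inj₁ refl = trans (cong (λ w → lookup w j) (swapˡ x (x [ i ]≔ c))) (lookup∘update′ j≢i x c)
      ... | inj₂ (inj₁ refl) =
        trans (cong (λ w → lookup w j) (swapʳ x (x [ i ]≔ c))) (sym (lookup∘update′ j≢i x c))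
      ... | inj₂ (inj₂ (z≢x , z≢x′)) = cong (λ w → lookup w j) (swap-fix z≢x z≢x′)

    module _ (L : List A) (full : ∀ c → c ∈ L) where

      transpositions⇒all : (S : Pred (Perm (Vec A n)) p) →
        (∀ f → IsTransposition f → Generated (Sym (Vec A n)) S f) →
        ∀ f → Generated (Sym (Vec A n)) S f
      transpositions⇒all S tr f
        with ts , tts , f≈ ← decompose (allVecs L _) (allVecs-complete L full) f =
        resp (λ x → sym (f≈ x)) (product∈ tr tts)
        where open Cosets S

      G-full : ∀ f → G A n n f
      G-full {n} = transpositions⇒all _ λ f tf → resp (λ _ → refl)
        -- For `t = ε` the coset is the subgroup itself.
        (transposition-≋ ε (update-connected (SwapIn ε) (SwapIn-trans ε)
          (λ _ x≢x → contradiction refl x≢x)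
          (λ x i c _ → resp {g = swap x (x [ i ]≔ c)} (λ _ → refl) (gen (swap-update-instruction x i c)))) f tf)
        where open Cosets (IsAryInstruction n)

      trivial? : (f : Perm (Vec A n)) (i : Fin n) → Dec (Trivial f i)
      trivial? f i = map′ (λ h x → All.lookup h (allVecs-complete L full x)) (λ h → All.universal h _)
                          (All.all? (λ x → coord f i x ≟ lookup x i) (allVecs L _))

      -- An instruction is defined by comparing nontrivial coordinates; deciding triviality over the
      -- finite set of points produces the exceptional index. If every coordinate is trivial, `zero`
      -- serves as that index.
      instruction⇒trivial-off : (f : Perm (Vec A (suc n))) → IsInstruction f →
                                ∃[ j ] (∀ i → i ≢ j → Trivial f i)
      instruction⇒trivial-off f ins with any? (λ j → ¬? (trivial? f j))
      ... | yes (j , ¬j) = j , λ i i≢j → decidable-stable (trivial? f i) λ ¬i → i≢j (ins i j ¬i ¬j)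
      ... | no  none     = zero , λ i _ → decidable-stable (trivial? f i) λ ¬i → none (i , ¬i)

-- Inverses of even permutations, and subgroups generated by them.

inverse-product : (_≟_ : DecidableEquality X) (ts : List (Perm X)) → All IsTransposition ts →
  Σ[ us ∈ List (Perm X) ] All IsTransposition us × length us ≡ length ts × product ts ⁻¹ ≈ product us
inverse-product _≟_ []       []         = [] , [] , refl , λ _ → refl
inverse-product _≟_ (t ∷ ts) (tt ∷ tts)
  with us , tus , eq , ts⁻¹≈ ← inverse-product _≟_ ts tts =
  -- Reversing the list inverts the product, because transpositions are involutions.
  us ++ t ∷ [] , ++⁺ tus (tt ∷ []) ,
  trans (length-++ us) (trans (+-comm (length us) 1) (cong suc eq)) ,
  λ x → trans (ts⁻¹≈ (from t x)) (trans
    (cong (to (product us)) (Transposition.transposition-self-inverse _≟_ t tt x))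
    (sym (product-++ us (t ∷ []) x)))

Alt-inv : (_≟_ : DecidableEquality X) {f : Perm X} → Alt f → Alt (f ⁻¹)
Alt-inv _≟_ {f} (ts , tts , 2∣ts , f≈)
  with us , tus , eq , ts⁻¹≈ ← inverse-product _≟_ ts tts =
  us , tus , subst (2 ∣_) (sym eq) 2∣ts ,
  λ x → trans (Group.⁻¹-cong (Sym _) {f} {product ts} f≈ x) (ts⁻¹≈ x)

generated⊆Alt : (_≟_ : DecidableEquality X) {S : Pred (Perm X) p} → S ⊆ Alt → Generated (Sym X) S ⊆ Alt
generated⊆Alt _≟_ S⊆ (gen s)                = S⊆ s
generated⊆Alt _≟_ S⊆ unit                   = Alt-unit
generated⊆Alt _≟_ S⊆ (mul {f} {g} Gf Gg)    =
  Alt-mul {f = f} {g} (generated⊆Alt _≟_ S⊆ Gf) (generated⊆Alt _≟_ S⊆ Gg)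
generated⊆Alt _≟_ S⊆ (inv {f} Gf)           = Alt-inv _≟_ {f} (generated⊆Alt _≟_ S⊆ Gf)
generated⊆Alt _≟_ S⊆ (resp {f} {g} f≈g Gf)  = Alt-resp {f = f} {g} f≈g (generated⊆Alt _≟_ S⊆ Gf)

-- Ignored variables and restriction to fewer coordinates.

missed-index : (ks : Vec (Fin (suc m)) m) → ∃[ k ] (∀ i → lookup ks i ≢ k)
missed-index {m} ks with all? (λ k → any? (λ i → lookup ks i ≟ᶠ k))
... | no ¬hit with k , ¬k ← ¬∀⟶∃¬ (suc m) _ (λ k → any? (λ i → lookup ks i ≟ᶠ k)) ¬hit =
  k , λ i e → ¬k (i , e)
-- Choosing a position for every index would inject `suc m` indices into `m` positions.
... | yes hit with i , j , i<j , e ← pigeonhole (n<1+n m) (proj₁ ∘ hit) =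
  contradiction i<j (<-irrefl (trans (sym (proj₂ (hit i))) (trans (cong (lookup ks) e) (proj₂ (hit j)))))

ary-insensitive : {g : Vec A (suc n) → A} ((ks , _) : IsAry l g) {k : Fin (suc n)} →
  (∀ i → lookup ks i ≢ k) → ∀ x c d → g (insertAt x k c) ≡ g (insertAt x k d)
ary-insensitive (ks , h , g≗) {k} missed x c d =
  trans (g≗ _) (trans (cong h (map-cong-on ks same)) (sym (g≗ _)))
  where
  same : ∀ i → lookup (insertAt x k c) (lookup ks i) ≡ lookup (insertAt x k d) (lookup ks i)
  same i with lookup ks i | missed i
  ... | j | j≢k with punchView k j
  ...   | here    = contradiction refl j≢k
  ...   | punch _ = trans (insertAt-punchIn x k c _) (sym (insertAt-punchIn x k d _))

-- The two images agree off `j` already, so agreement at `j` contradicts injectivity unless `c` and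
-- `d` coincide. An instruction therefore reads the variable that it changes.
sensitive : {f : Perm (Vec A (suc n))} (j : Fin (suc n)) → (∀ i → i ≢ j → Trivial f i) →
  ∀ x {c d} → coord f j (insertAt x j c) ≡ coord f j (insertAt x j d) → c ≡ d
sensitive {f = f} j off x {c} {d} e = insertAt-injectiveʳ j (to-injective f (lookup-ext same))
  where
  same : ∀ i → coord f i (insertAt x j c) ≡ coord f i (insertAt x j d)
  same i with punchView j i
  ... | here     = e
  ... | punch i′ = trans (off _ (punchInᵢ≢i j i′) _) (trans (insertAt-punchIn x j c i′)
    (sym (trans (off _ (punchInᵢ≢i j i′) _) (insertAt-punchIn x j d i′))))

-- The inverse of `emb`: `f` preserves every layer of coordinate `k` and acts alike on all of them,
-- so the layer at `c₀` determines it.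
restrict : (f : Perm (Vec A (suc n))) (k : Fin (suc n)) → A → Trivial f k →
  (∀ i x c d → coord f (punchIn k i) (insertAt x k c) ≡ coord f (punchIn k i) (insertAt x k d)) →
  Σ[ g ∈ Perm (Vec A n) ] emb k g ≈ f
restrict {A = A} {n} f k c₀ triv blind = g , emb≈
  where
  g-to g-from : Vec A n → Vec A n
  g-to   x = removeAt (to f (insertAt x k c₀)) k
  g-from x = removeAt (from f (insertAt x k c₀)) k

  f-insertAt : ∀ x c → to f (insertAt x k c) ≡ insertAt (g-to x) k c
  f-insertAt x c = lookup-ext eq
    where
    eq : ∀ j → lookup (to f (insertAt x k c)) j ≡ lookup (insertAt (g-to x) k c) j
    eq j with punchView k j
    ... | here    = trans (triv _) (trans (insertAt-lookup x k c) (sym (insertAt-lookup (g-to x) k c)))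
    ... | punch i = trans (blind i x c c₀)
      (trans (sym (lookup-removeAt (to f (insertAt x k c₀)) k i)) (sym (insertAt-punchIn (g-to x) k c i)))

  to-from : ∀ y → g-to (g-from y) ≡ y
  to-from y = insertAt-injectiveˡ k (trans (sym (f-insertAt (g-from y) c₀)) (trans
      (cong (to f) (trans (cong (insertAt (g-from y) k) (sym w-k)) (insertAt-removeAt w k)))
      f-w))
    where
    w : Vec A (suc n)
    w = from f (insertAt y k c₀)
    f-w : to f w ≡ insertAt y k c₀
    f-w = strictlyInverseˡ f _
    -- The preimage stays in the layer, since `f` does not alter coordinate `k`.
    w-k : lookup w k ≡ c₀
    w-k = trans (sym (triv w)) (trans (cong (λ z → lookup z k) f-w) (insertAt-lookup y k c₀))

  from-to : ∀ x → g-from (g-to x) ≡ x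
  from-to x = trans
    (cong (λ z → removeAt z k) (trans (cong (from f) (sym (f-insertAt x c₀))) (strictlyInverseʳ f _)))
    (removeAt-insertAt x k c₀)

  g : Perm (Vec A n)
  g = mk↔ₛ′ g-to g-from to-from from-to

  emb≈ : emb k g ≈ f
  emb≈ x = trans (sym (f-insertAt (removeAt x k) (lookup x k))) (cong (to f) (insertAt-removeAt x k))

-- Parallel copies of transpositions, and evenness for even q.

module _ {A : Set a} (_≟_ : DecidableEquality A) where

  private
    module T {n : ℕ} = Transposition (_≟ⱽ_ _≟_ {n})
  open T

  copies : Fin (suc n) → Vec A n → Vec A n → List A → List (Perm (Vec A (suc n)))
  copies k u v = List.map (λ c → swap (insertAt u k c) (insertAt v k c))

  length-copies : (k : Fin (suc n)) (u v : Vec A n) → ∀ L → length (copies k u v L) ≡ length L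
  length-copies k u v L = length-map _ L

  copies-transpositions : (k : Fin (suc n)) {u v : Vec A n} → u ≢ v →
                          ∀ L → All IsTransposition (copies k u v L)
  copies-transpositions k u≢v []      = []
  copies-transpositions k u≢v (c ∷ L) =
    swap-isTransposition (u≢v ∘ insertAt-injectiveˡ k) ∷ copies-transpositions k u≢v L

  swap-insertAt : (k : Fin (suc n)) (u v x : Vec A n) (c : A) →
    swap-to (insertAt u k c) (insertAt v k c) (insertAt x k c) ≡ insertAt (swap-to u v x) k c
  swap-insertAt k u v x c with locate u v x
  ... | inj₁ refl        = trans (swapˡ (insertAt u k c) (insertAt v k c)) (cong (λ z → insertAt z k c) (sym (swapˡ u v)))
  ... | inj₂ (inj₁ refl) = trans (swapʳ (insertAt u k c) (insertAt v k c)) (cong (λ z → insertAt z k c) (sym (swapʳ u v)))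
  ... | inj₂ (inj₂ (x≢u , x≢v)) =
    trans (swap-fix (x≢u ∘ insertAt-injectiveˡ k) (x≢v ∘ insertAt-injectiveˡ k))
          (cong (λ z → insertAt z k c) (sym (swap-fix x≢u x≢v)))

  swap-insertAt-≢ : (k : Fin (suc n)) (u v x : Vec A n) {c d : A} → d ≢ c →
    swap-to (insertAt u k c) (insertAt v k c) (insertAt x k d) ≡ insertAt x k d
  swap-insertAt-≢ k u v x d≢c =
    swap-fix (d≢c ∘ insertAt-injectiveʳ k) (d≢c ∘ insertAt-injectiveʳ k)

  product-copies-∉ : (k : Fin (suc n)) (u v x : Vec A n) (L : List A) {d : A} → d ∉ L →
    to (product (copies k u v L)) (insertAt x k d) ≡ insertAt x k d
  product-copies-∉ k u v x []      d∉ = refl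
  product-copies-∉ k u v x (c ∷ L) d∉ =
    trans (cong (swap-to _ _) (product-copies-∉ k u v x L (d∉ ∘ there)))
          (swap-insertAt-≢ k u v x (d∉ ∘ here))

  product-copies-∈ : (k : Fin (suc n)) (u v x : Vec A n) {L : List A} {d : A} → Unique L → d ∈ L →
    to (product (copies k u v L)) (insertAt x k d) ≡ insertAt (swap-to u v x) k d
  product-copies-∈ k u v x {c ∷ L} uniq (here refl) =
    trans (cong (swap-to _ _) (product-copies-∉ k u v x L (Unique[x∷xs]⇒x∉xs uniq)))
          (swap-insertAt k u v x c)
  product-copies-∈ k u v x {c ∷ L} uniq@(_ ∷ uniqL) (there d∈L) =
    trans (cong (swap-to _ _) (product-copies-∈ k u v x uniqL d∈L))
          (swap-insertAt-≢ k u v (swap-to u v x) λ { refl → Unique[x∷xs]⇒x∉xs uniq d∈L })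

  module _ (L : List A) (full : ∀ c → c ∈ L) (uniq : Unique L) where

    -- The copies live in disjoint layers, and `L` lists every value once, so exactly one copy acts
    -- in the layer of a given point.
    emb-swap : (k : Fin (suc n)) (u v : Vec A n) → product (copies k u v L) ≈ emb k (swap u v)
    emb-swap k u v x = trans (cong (to (product (copies k u v L))) (sym (insertAt-removeAt x k)))
                             (product-copies-∈ k u v (removeAt x k) uniq (full (lookup x k)))

    -- Each transposition in a decomposition of `g`, even or odd, becomes `length L` transpositions.
    emb-Alt : 2 ∣ length L → (k : Fin (suc n)) (g : Perm (Vec A n)) → Alt (emb k g)
    emb-Alt 2∣L k g
      with ts , tts , g≈ ← decompose (allVecs L _) (allVecs-complete L full) g =
      Alt-resp {f = emb k (product ts)} {emb k g}
               (emb-cong k {product ts} {g} (λ x → sym (g≈ x))) (even ts tts)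
      where
      even : ∀ ts → All IsTransposition ts → Alt (emb k (product ts))
      even []       []         = Alt-resp {f = ε} {emb k ε} (emb-unit k) Alt-unit
      even (t ∷ ts) ((u , v , u≢v , tu , tv , fix) ∷ tts) =
        Alt-resp {f = emb k t ∙ emb k (product ts)} {emb k (product (t ∷ ts))} (emb-mul k t (product ts))
          (Alt-mul {f = emb k t} {emb k (product ts)}
            (copies k u v L , copies-transpositions k u≢v L ,
             subst (2 ∣_) (sym (length-copies k u v L)) 2∣L ,
             λ x → trans (emb-cong k {t} {swap u v} (swap-unique t tu tv fix) x) (sym (emb-swap k u v x)))
            (even ts tts))

    G⊆Alt : 2 ∣ length L → HasOther A → A → G A (suc m) m ⊆ Alt
    G⊆Alt {m} 2∣L other c₀ = generated⊆Alt (_≟ⱽ_ _≟_) (λ {f} → instruction-Alt {f})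
      where
      instruction-Alt : IsAryInstruction m ⊆ Alt
      instruction-Alt {f} (ins , ary)
        with j , off ← instruction⇒trivial-off _≟_ L full f ins
        with k , missed ← missed-index (proj₁ (ary j))
        with punchView k j
      -- The missed variable cannot be the one that `f` changes: two distinct values of it would
      -- give the same image.
      ... | here = contradiction
        (sensitive {f = f} k off (replicate m c₀)
          (ary-insensitive {g = coord f k} (ary k) missed (replicate m c₀) (proj₁ (other c₀)) c₀))
        (proj₂ (other c₀))
      ... | punch j′ = Alt-resp {f = emb k (proj₁ g)} {f} (proj₂ g) (emb-Alt 2∣L k (proj₁ g))
        where
        blind : ∀ i x c d → coord f (punchIn k i) (insertAt x k c) ≡ coord f (punchIn k i) (insertAt x k d)
        blind i x c d with punchIn k i ≟ᶠ punchIn k j′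
        ... | yes e rewrite e = ary-insensitive (ary (punchIn k j′)) missed x c d
        ... | no  ≢j = trans (off _ ≢j _) (trans (insertAt-punchIn x k c i)
          (sym (trans (off _ ≢j _) (insertAt-punchIn x k d i))))
        g : Σ[ g ∈ Perm (Vec A m) ] emb k g ≈ f
        g = restrict f k c₀ (off k (≢-sym (punchInᵢ≢i k j′))) blind

-- Raising the dimension: `Alt` inside the group of instructions of fixed arity.

third-∷ : A → HasThird (Vec A n) → HasThird (Vec A (suc n))
third-∷ c third (x ∷ r) (y ∷ s) with t , t≢r , t≢s ← third r s =
  c ∷ t , t≢r ∘ ∷-injectiveʳ , t≢s ∘ ∷-injectiveʳ

third-≤′ : A → m ≤′ n → HasThird (Vec A m) → HasThird (Vec A n)
third-≤′ c ≤′-refl       third = third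
third-≤′ c (≤′-step m≤n) third = third-∷ c (third-≤′ c m≤n third)

module _ {A : Set a} (_≟_ : DecidableEquality A) (c₀ : A) (other : HasOther A) where

  private
    module T {n : ℕ} = Transposition (_≟ⱽ_ _≟_ {n})
  open T

  -- The 3-cycle sends `u` to `v` to `w` to `u`. Apart from `u` it moves only points with tail `r`,
  -- which makes its support easy to separate from another one.
  module Line {m : ℕ} {x x′ : A} {s r : Vec A m} (s≢r : s ≢ r) where

    private
      u v w : Vec A (suc m)
      u = x ∷ s
      v = x′ ∷ r
      w = proj₁ (other x′) ∷ r

    cycle : Perm (Vec A (suc m))
    cycle = swap u v ∙ swap v w

    cycle-Alt : Alt cycle
    cycle-Alt = swap-Alt (s≢r ∘ ∷-injectiveʳ) (≢-sym (proj₂ (other x′)) ∘ ∷-injectiveˡ)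

    cycle-start : to cycle u ≡ v
    cycle-start = trans (cong (swap-to u v) (swap-fix (s≢r ∘ ∷-injectiveʳ) (s≢r ∘ ∷-injectiveʳ))) (swapˡ u v)

    cycle-fix : ∀ {z zs} → z ∷ zs ≢ u → zs ≢ r → to cycle (z ∷ zs) ≡ z ∷ zs
    cycle-fix ≢u zs≢r =
      trans (cong (swap-to u v) (swap-fix (zs≢r ∘ ∷-injectiveʳ) (zs≢r ∘ ∷-injectiveʳ)))
            (swap-fix ≢u (zs≢r ∘ ∷-injectiveʳ))

  module AltStep {m l : ℕ} (third : HasThird (Vec A m)) (Alt⊆G : Alt ⊆ G A (suc m) (suc l)) where

    open Cosets {2 + m} (IsAryInstruction (suc l))

    V : Set a
    V = Vec A (2 + m)

    -- A point moved by `σ` has tail `r`, or first coordinate `x` and tail `s`; one moved by `τ` has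
    -- tail `t`, or second coordinate `y` and tail `s`. As the three tails differ, only `o` is moved
    -- by both, and the commutator is the required quotient.
    fork : ∀ {x y x′ y′ s r t} → s ≢ r → s ≢ t → r ≢ t →
           swap (x ∷ y ∷ s) (x ∷ y′ ∷ t) ≋ swap (x ∷ y ∷ s) (x′ ∷ y ∷ r)
    fork {x} {y} {x′} {y′} {s} {r} {t} s≢r s≢t r≢t =
      resp (λ z → trans (commutator-3-cycle σ τ σo≢o τo≢o disjoint z)
                        (cong₂ (λ b a → swap-to o b (swap-to o a z)) τo σo))
           (mul (mul Gσ Gτ) (mul (inv Gσ) (inv Gτ)))
      where
      module S = Line {x = x} {x′} s≢r
      module R = Line {x = y} {y′} s≢t
      o : V
      o = x ∷ y ∷ s
      σ τ : Perm V
      σ = emb (suc zero) S.cycle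
      τ = emb zero R.cycle
      Gσ : H σ
      Gσ = emb-G (suc zero) (Alt⊆G {S.cycle} S.cycle-Alt)
      Gτ : H τ
      Gτ = emb-G zero (Alt⊆G {R.cycle} R.cycle-Alt)
      σo : to σ o ≡ x′ ∷ y ∷ r
      σo = cong (λ z → insertAt z (suc zero) y) S.cycle-start
      τo : to τ o ≡ x ∷ y′ ∷ t
      τo = cong (x ∷_) R.cycle-start
      σo≢o : to σ o ≢ o
      σo≢o e = s≢r (cong (tail ∘ tail) (trans (sym e) σo))
      τo≢o : to τ o ≢ o
      τo≢o e = s≢t (cong (tail ∘ tail) (trans (sym e) τo))
      σ-fix : ∀ z₀ z₁ zs → z₀ ∷ zs ≢ x ∷ s → zs ≢ r → to σ (z₀ ∷ z₁ ∷ zs) ≡ z₀ ∷ z₁ ∷ zs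
      σ-fix z₀ z₁ zs ≢u zs≢r = cong (λ z → insertAt z (suc zero) z₁) (S.cycle-fix ≢u zs≢r)
      τ-fix : ∀ z₀ z₁ zs → z₁ ∷ zs ≢ y ∷ s → zs ≢ t → to τ (z₀ ∷ z₁ ∷ zs) ≡ z₀ ∷ z₁ ∷ zs
      τ-fix z₀ z₁ zs ≢u zs≢t = cong (z₀ ∷_) (R.cycle-fix ≢u zs≢t)
      disjoint : ∀ z → z ≢ o → to σ z ≡ z ⊎ to τ z ≡ z
      disjoint (z₀ ∷ z₁ ∷ zs) z≢o = by-cases (_≟ⱽ_ _≟_ zs s) (_≟ⱽ_ _≟_ zs r) (z₀ ≟ x)
        where
        by-cases : Dec (zs ≡ s) → Dec (zs ≡ r) → Dec (z₀ ≡ x) →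
                   to σ (z₀ ∷ z₁ ∷ zs) ≡ z₀ ∷ z₁ ∷ zs ⊎ to τ (z₀ ∷ z₁ ∷ zs) ≡ z₀ ∷ z₁ ∷ zs
        by-cases (no zs≢s)  (no zs≢r)  _          = inj₁ (σ-fix z₀ z₁ zs (zs≢s ∘ ∷-injectiveʳ) zs≢r)
        by-cases (no zs≢s)  (yes refl) _          = inj₂ (τ-fix z₀ z₁ zs (zs≢s ∘ ∷-injectiveʳ) r≢t)
        by-cases (yes refl) _          (no z₀≢x)  = inj₁ (σ-fix z₀ z₁ zs (z₀≢x ∘ ∷-injectiveˡ) s≢r)
        by-cases (yes refl) _          (yes refl) =
          inj₂ (τ-fix z₀ z₁ zs (λ e → z≢o (cong (z₀ ∷_) e)) s≢t)

    -- The pairs exchanged by the transpositions that `fork` compares.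
    Near : V → V → Set a
    Near (x ∷ y ∷ s) (x′ ∷ y′ ∷ s′) = s ≢ s′ × (x ≡ x′ ⊎ y ≡ y′)

    near-sym : ∀ u v → Near u v → Near v u
    near-sym (_ ∷ _ ∷ _) (_ ∷ _ ∷ _) (s≢s′ , inj₁ e) = ≢-sym s≢s′ , inj₁ (sym e)
    near-sym (_ ∷ _ ∷ _) (_ ∷ _ ∷ _) (s≢s′ , inj₂ e) = ≢-sym s≢s′ , inj₂ (sym e)

    near-connected : ∀ u v → ∃[ w ] Near u w × Near w v
    near-connected (x ∷ y ∷ s) (x′ ∷ y′ ∷ s′) with t , t≢s , t≢s′ ← third s s′ =
      x′ ∷ y ∷ t , (≢-sym t≢s , inj₂ refl) , (t≢s′ , inj₁ refl)

    -- The point `x ∷ y ∷ t` shares both leading coordinates with `x ∷ y ∷ s`, so it can stand on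
    -- either side of `fork` and links the two kinds of neighbours.
    hub : ∀ x y s v → Near (x ∷ y ∷ s) v →
          ∃[ t ] s ≢ t × swap (x ∷ y ∷ s) v ≋ swap (x ∷ y ∷ s) (x ∷ y ∷ t)
    hub x y s (.x ∷ y′ ∷ r) (s≢r , inj₁ refl) with t , t≢s , t≢r ← third s r =
      t , ≢-sym t≢s , fork (≢-sym t≢s) s≢r t≢r
    hub x y s (x′ ∷ .y ∷ r) (s≢r , inj₂ refl) with t , t≢s , t≢r ← third s r =
      t , ≢-sym t≢s , ≋-sym (swap (x ∷ y ∷ s) (x ∷ y ∷ t)) (swap (x ∷ y ∷ s) (x′ ∷ y ∷ r))
                            (fork s≢r (≢-sym t≢s) (≢-sym t≢r))

    hubs-≋ : ∀ x y s t t′ → s ≢ t → s ≢ t′ →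
             swap (x ∷ y ∷ s) (x ∷ y ∷ t) ≋ swap (x ∷ y ∷ s) (x ∷ y ∷ t′)
    hubs-≋ x y s t t′ s≢t s≢t′ with _≟ⱽ_ _≟_ t t′
    ... | yes refl = resp (λ z → sym (swap-involutive _ _ z)) unit
    ... | no  t≢t′ = fork s≢t′ s≢t (≢-sym t≢t′)

    star : ∀ u v w → Near u v → Near u w → swap u v ≋ swap u w
    star u@(x ∷ y ∷ s) v w uv uw
      with t , s≢t , v≋t ← hub x y s v uv
      with t′ , s≢t′ , w≋t′ ← hub x y s w uw =
      ≋-trans (swap u v) (swap u (x ∷ y ∷ t)) (swap u w) v≋t
        (≋-trans (swap u (x ∷ y ∷ t)) (swap u (x ∷ y ∷ t′)) (swap u w) (hubs-≋ x y s t t′ s≢t s≢t′)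
          (≋-sym (swap u w) (swap u (x ∷ y ∷ t′)) w≋t′))

    base : V
    base = replicate _ c₀

    -- A representative of the common coset; any transposition of near points would do.
    t₀ : Perm V
    t₀ = swap base (proj₁ (near-connected base base))

    NearIn : V → Set _
    NearIn u = ∀ v → Near u v → swap u v ≋ t₀

    -- The transposition (u v) belongs to the stars of both `u` and `v`, and each star lies in a
    -- single coset, so the two cosets coincide.
    nearIn-step : ∀ u v → Near u v → NearIn u → NearIn v
    nearIn-step u v uv u-in w vw =
      ≋-trans (swap v w) (swap v u) t₀ (star v w u vw (near-sym u v uv))
        (≋-respˡ (swap u v) (swap v u) t₀ (swap-comm u v) (u-in v uv))

    nearIn : ∀ u → NearIn u
    nearIn u with w , bw , wu ← near-connected base u =
      nearIn-step w u wu (nearIn-step base w bw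
        λ v bv → star base v _ bv (proj₁ (proj₂ (near-connected base base))))

    swapIn : ∀ u v → SwapIn t₀ u v
    swapIn u v with w , uw , wv ← near-connected u v =
      SwapIn-trans t₀ (λ _ → nearIn u w uw) (λ _ → nearIn w v wv)

    Alt⊆G-suc : Alt ⊆ G A (2 + m) (suc l)
    Alt⊆G-suc = all-SwapIn⇒Alt⊆ t₀ swapIn

  module _ (L : List A) (full : ∀ c → c ∈ L) {l : ℕ} (third : HasThird (Vec A l)) where

    -- The induction starts in dimension `suc l`, where the arity is full. In each later step two
    -- coordinates are split off, and the remaining tail still has length at least `l`, so a third
    -- tail exists.
    Alt⊆G : l ≤′ m → Alt ⊆ G A (suc m) (suc l)
    Alt⊆G ≤′-refl       {f} _   = G-full _≟_ L full f
    Alt⊆G (≤′-step l≤m) {f} alt = AltStep.Alt⊆G-suc (third-≤′ c₀ l≤m third) (λ {g} → Alt⊆G l≤m {g}) {f} alt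

    Sym⊆G : Unique L → ¬ 2 ∣ length L → l ≤′ m → ∀ f → G A (suc m) (suc l) f
    Sym⊆G uniq odd ≤′-refl f = G-full _≟_ L full f
    Sym⊆G {suc m} uniq odd (≤′-step l≤m) = transpositions⇒all _≟_ L full _ tr
      where
      u v : Vec A (suc m)
      u = replicate _ c₀
      v = proj₁ (other c₀) ∷ replicate _ c₀
      u≢v : u ≢ v
      u≢v e = proj₂ (other c₀) (sym (∷-injectiveˡ e))
      ts : List (Perm (Vec A (2 + m)))
      ts = copies _≟_ zero u v L
      product∈G : G A (2 + m) (suc l) (product ts)
      product∈G = resp (λ x → sym (emb-swap _≟_ L full uniq zero u v x))
                       (emb-G zero (Sym⊆G uniq odd l≤m (swap u v)))
      2∣1+ts : 2 ∣ suc (length ts)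
      2∣1+ts with even-or-odd (length L)
      ... | inj₁ 2∣L   = contradiction 2∣L odd
      ... | inj₂ 2∣1+L = subst (λ k → 2 ∣ suc k) (sym (length-copies _≟_ zero u v L)) 2∣1+L
      tr : ∀ f → IsTransposition f → G A (2 + m) (suc l) f
      tr f tf = resp (λ x → cong (to f) (strictlyInverseˡ (product ts) x))
        -- With q odd, `f` and the q parallel copies together make an even number of transpositions;
        -- the copies lie in the group by induction and are cancelled afterwards.
        (mul (Alt⊆G (≤′-step l≤m) {f ∙ product ts}
               (f ∷ ts , tf ∷ copies-transpositions _≟_ zero u≢v L , 2∣1+ts , λ _ → refl))
             (inv product∈G))

-- The affine group over GF(2)

module _ {B : Set b} (φ : A ↔ B) where

  map-to-from : (y : Vec B n) → map (to φ) (map (from φ) y) ≡ y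
  map-to-from y = trans (sym (map-∘ (to φ) (from φ) y)) (trans (map-cong (strictlyInverseˡ φ) y) (map-id y))

  map-from-to : (x : Vec A n) → map (from φ) (map (to φ) x) ≡ x
  map-from-to x = trans (sym (map-∘ (from φ) (to φ) x)) (trans (map-cong (strictlyInverseʳ φ) x) (map-id x))

  -- Conjugation by `φ` in every coordinate, which carries questions about a two-element `A` to
  -- `Bool`.
  relabel : Perm (Vec A n) → Perm (Vec B n)
  relabel f = mk↔ₛ′ (λ y → map (to φ) (to f (map (from φ) y))) (λ y → map (to φ) (from f (map (from φ) y)))
    (λ y → trans (cong (map (to φ)) (trans (cong (to f) (map-from-to _)) (strictlyInverseˡ f _))) (map-to-from y))
    (λ y → trans (cong (map (to φ)) (trans (cong (from f) (map-from-to _)) (strictlyInverseʳ f _))) (map-to-from y))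

  relabel-coord : (f : Perm (Vec A n)) → ∀ i y → coord (relabel f) i y ≡ to φ (coord f i (map (from φ) y))
  relabel-coord f i y = lookup-map i (to φ) (to f (map (from φ) y))

  relabel-instruction : (f : Perm (Vec A n)) → IsAryInstruction l f → IsAryInstruction l (relabel f)
  relabel-instruction f (ins , ary) = (λ i j ¬i ¬j → ins i j (¬i ∘ triv i) (¬j ∘ triv j)) , ary′
    where
    triv : ∀ i → Trivial f i → Trivial (relabel f) i
    triv i t y = trans (relabel-coord f i y) (trans (cong (to φ) (trans (t _) (lookup-map i (from φ) y)))
                                                    (strictlyInverseˡ φ (lookup y i)))
    ary′ : ∀ j → IsAry _ (coord (relabel f) j)
    ary′ j with ks , h , eq ← ary j = ks , to φ ∘ h ∘ map (from φ) , λ y →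
      trans (relabel-coord f j y) (cong (to φ) (trans (eq _) (cong h
        (trans (map-cong (λ k → lookup-map k (from φ) y) ks) (map-∘ (from φ) (lookup y) ks)))))

  relabel-G : {f : Perm (Vec A n)} → G A n l f → G B n l (relabel f)
  relabel-G {f = f} (gen s)         = gen (relabel-instruction f s)
  relabel-G unit                    = resp (λ y → sym (map-to-from y)) unit
  relabel-G (mul {f} {g} Gf Gg)     =
    resp (λ y → cong (map (to φ) ∘ to f) (map-from-to _)) (mul (relabel-G Gf) (relabel-G Gg))
  relabel-G (inv Gf)                = resp (λ _ → refl) (inv (relabel-G Gf))
  relabel-G (resp f≈g Gf)           = resp (λ y → cong (map (to φ)) (f≈g _)) (relabel-G Gf)

-- Affine maps through ternary sums.

infixr 6 _⊕_
_⊕_ : Vec Bool n → Vec Bool n → Vec Bool n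
_⊕_ = zipWith _xor_

𝟎 : Vec Bool n
𝟎 = replicate _ false

⊕-assoc : (x y z : Vec Bool n) → (x ⊕ y) ⊕ z ≡ x ⊕ (y ⊕ z)
⊕-assoc = zipWith-assoc xor-assoc

⊕-self : (x : Vec Bool n) → x ⊕ x ≡ 𝟎
⊕-self []      = refl
⊕-self (c ∷ x) = cong₂ _∷_ (xor-same c) (⊕-self x)

⊕-identityˡ : (x : Vec Bool n) → 𝟎 ⊕ x ≡ x
⊕-identityˡ = zipWith-identityˡ xor-identityˡ

⊕-identityʳ : (x : Vec Bool n) → x ⊕ 𝟎 ≡ x
⊕-identityʳ []      = refl
⊕-identityʳ (c ∷ x) = cong₂ _∷_ (xor-identityʳ c) (⊕-identityʳ x)

⊕-cancelʳ : (x y : Vec Bool n) → (x ⊕ y) ⊕ y ≡ x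
⊕-cancelʳ x y = trans (⊕-assoc x y y) (trans (cong (x ⊕_) (⊕-self y)) (⊕-identityʳ x))

-- In this form, free of matrices, affinity passes directly to composites and inverses.
Affine : (Vec Bool m → Vec Bool n) → Set
Affine F = ∀ x y z → F (x ⊕ y ⊕ z) ≡ F x ⊕ F y ⊕ F z

AffineFn : (Vec Bool n → Bool) → Set
AffineFn c = ∀ x y z → c (x ⊕ y ⊕ z) ≡ c x xor (c y xor c z)

lookup-⊕ : (x y z : Vec Bool n) → ∀ i →
           lookup (x ⊕ y ⊕ z) i ≡ lookup x i xor (lookup y i xor lookup z i)
lookup-⊕ x y z i = trans (lookup-zipWith _xor_ i x (y ⊕ z)) (cong (lookup x i xor_) (lookup-zipWith _xor_ i y z))

affine⇒coordinates : {F : Vec Bool m → Vec Bool n} → Affine F → ∀ i → AffineFn (λ x → lookup (F x) i)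
affine⇒coordinates {F = F} aff i x y z =
  trans (cong (λ w → lookup w i) (aff x y z)) (lookup-⊕ (F x) (F y) (F z) i)

coordinates⇒affine : {F : Vec Bool m → Vec Bool n} → (∀ i → AffineFn (λ x → lookup (F x) i)) → Affine F
coordinates⇒affine {F = F} aff x y z =
  lookup-ext λ i → trans (aff i x y z) (sym (lookup-⊕ (F x) (F y) (F z) i))

affine-∘ : {F : Vec Bool m → Vec Bool n} {E : Vec Bool l → Vec Bool m} →
           Affine F → Affine E → Affine (F ∘ E)
affine-∘ {F = F} affF affE x y z = trans (cong F (affE x y z)) (affF _ _ _)

affine-from : (F : Perm (Vec Bool n)) → Affine (to F) → Affine (from F)
affine-from F aff x y z = trans (cong (from F) (sym eq)) (strictlyInverseʳ F _)
  where
  eq : to F (from F x ⊕ from F y ⊕ from F z) ≡ x ⊕ y ⊕ z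
  eq = trans (aff _ _ _) (cong₂ _⊕_ (strictlyInverseˡ F x)
             (cong₂ _⊕_ (strictlyInverseˡ F y) (strictlyInverseˡ F z)))

affineFn-ext : {c d : Vec Bool n → Bool} → (∀ x → c x ≡ d x) → AffineFn c → AffineFn d
affineFn-ext eq aff x y z = trans (sym (eq _)) (trans (aff x y z)
  (cong₂ _xor_ (eq x) (cong₂ _xor_ (eq y) (eq z))))

affineFn-const : ∀ b → AffineFn {n} (λ _ → b)
affineFn-const false _ _ _ = refl
affineFn-const true  _ _ _ = refl

affineFn-xor : {c d : Vec Bool n → Bool} → AffineFn c → AffineFn d → AffineFn (λ x → c x xor d x)
affineFn-xor {c = c} {d} affc affd x y z =
  trans (cong₂ _xor_ (affc x y z) (affd x y z))
    (solve 6 (λ cx cy cz dx dy dz → (cx :+ (cy :+ cz)) :+ (dx :+ (dy :+ dz))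
                                 := (cx :+ dx) :+ ((cy :+ dy) :+ (cz :+ dz))) refl
           (c x) (c y) (c z) (d x) (d y) (d z))
  where open xor-∧-Solver

affineFn-∧ : ∀ b {c : Vec Bool n → Bool} → AffineFn c → AffineFn (λ x → b ∧ c x)
affineFn-∧ false aff = affineFn-const false
affineFn-∧ true  aff = aff

affineFn-sum : {c : Fin m → Vec Bool n → Bool} → (∀ j → AffineFn (c j)) →
               AffineFn (λ x → sum (λ j → c j x))
affineFn-sum {zero}  aff = affineFn-const false
affineFn-sum {suc m} {c = c} aff =
  affineFn-xor {c = c zero} (aff zero) (affineFn-sum (aff ∘ suc))

-- Among three bits two agree, and these cancel from the sum both before and after `h` is applied.
affineFn-unary : (h : Bool → Bool) (i : Fin n) → AffineFn (λ x → h (lookup x i))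
affineFn-unary h i x y z = trans (cong h (lookup-⊕ x y z i)) (unary (lookup x i) (lookup y i) (lookup z i))
  where
  ++- : ∀ s t → t ≡ s xor (s xor t)
  ++- false t = refl
  ++- true  false = refl
  ++- true  true  = refl
  +-+ : ∀ s t → t ≡ s xor (t xor s)
  +-+ s t = trans (++- s t) (cong (s xor_) (xor-comm s t))
  -++ : ∀ s t → t ≡ t xor (s xor s)
  -++ s t = sym (trans (cong (t xor_) (xor-same s)) (xor-identityʳ t))
  unary : ∀ r s t → h (r xor (s xor t)) ≡ h r xor (h s xor h t)
  unary false false t     = ++- (h false) (h t)
  unary false true  false = +-+ (h false) (h true)
  unary false true  true  = -++ (h true) (h false)
  unary true  false false = -++ (h false) (h true)
  unary true  false true  = +-+ (h true) (h false)
  unary true  true  false = ++- (h true) (h false)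
  unary true  true  true  = ++- (h true) (h true)

-- Binary instructions over GF(2) are affine.

flip⇒xor : (h : Bool → Bool → Bool) → (∀ t {c d} → h c t ≡ h d t → c ≡ d) → ∀ s t → h s t ≡ s xor h false t
flip⇒xor h inj false t = refl
-- Injectivity in the first argument makes the two values complementary.
flip⇒xor h inj true  t with h true t in eq | h false t in eq′
... | true  | false = refl
... | false | true  = refl
... | true  | true  with () ← inj t {true} {false} (trans eq (sym eq′))
... | false | false with () ← inj t {true} {false} (trans eq (sym eq′))

bools : List Bool
bools = true ∷ false ∷ []

bools-full : ∀ c → c ∈ bools
bools-full true  = here refl
bools-full false = there (here refl)

-- The exceptional coordinate reads its own variable and at most one other. Injectivity in its own
-- variable excludes products, leaving that variable plus a unary function of the other.
instruction-affine : (f : Perm (Vec Bool (suc n))) → IsAryInstruction 2 f → Affine (to f)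
instruction-affine {n} f (ins , ary)
  with j , off ← instruction⇒trivial-off _≟ᵇ_ bools bools-full f ins = coordinates⇒affine coordinate
  where
  mixed : (h : Bool → Bool → Bool) (i : Fin n) →
    (∀ x → coord f j x ≡ h (lookup x j) (lookup x (punchIn j i))) → AffineFn (coord f j)
  mixed h i f≗ =
    affineFn-ext (λ x → trans (sym (flip⇒xor h inj (lookup x j) (lookup x (punchIn j i)))) (sym (f≗ x)))
      (affineFn-xor {c = λ x → lookup x j} (affineFn-unary (λ s → s) j) (affineFn-unary (h false) (punchIn j i)))
    where
    -- A constant vector gives the other variable the value `t`, whatever its index.
    at : ∀ t c → coord f j (insertAt (replicate n t) j c) ≡ h c t
    at t c = trans (f≗ _) (cong₂ h (insertAt-lookup _ j c)
      (trans (insertAt-punchIn _ j c i) (lookup-replicate i t)))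
    inj : ∀ t {c d} → h c t ≡ h d t → c ≡ d
    inj t {c} {d} e = sensitive {f = f} j off (replicate n t) (trans (at t c) (trans e (sym (at t d))))

  nontrivial : AffineFn (coord f j)
  nontrivial with ary j
  ... | a ∷ b ∷ [] , h , f≗ with punchView j a | punchView j b
  ... | here | here = affineFn-ext (sym ∘ f≗) (affineFn-unary (λ s → h (s ∷ s ∷ [])) j)
  ... | here | punch i = mixed (λ s t → h (s ∷ t ∷ [])) i f≗
  ... | punch i | here = mixed (λ s t → h (t ∷ s ∷ [])) i f≗
  -- Neither variable read is `j`, so flipping entry `j` of `𝟎` would not change the image.
  ... | punch i | punch i′
    with () ← sensitive {f = f} j off 𝟎 {true} {false} (ary-insensitive {g = coord f j}
      (punchIn j i ∷ punchIn j i′ ∷ [] , h , f≗)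
      (λ { zero → punchInᵢ≢i j i ; (suc zero) → punchInᵢ≢i j i′ }) 𝟎 true false)

  coordinate : ∀ i → AffineFn (coord f i)
  coordinate i with i ≟ᶠ j
  ... | yes refl = nontrivial
  ... | no  i≢j  = affineFn-ext (sym ∘ off i i≢j) (affineFn-unary (λ s → s) i)

G2⊆affine : {f : Perm (Vec Bool (suc n))} → G Bool (suc n) 2 f → Affine (to f)
G2⊆affine {f = f} (gen s)         = instruction-affine f s
G2⊆affine unit                    = λ _ _ _ → refl
G2⊆affine (mul {f} {g} Gf Gg)     = affine-∘ {F = to f} (G2⊆affine Gf) (G2⊆affine Gg)
G2⊆affine (inv {f} Gf)            = affine-from f (G2⊆affine Gf)
G2⊆affine (resp f≈g Gf) x y z     = trans (sym (f≈g _)) (trans (G2⊆affine Gf x y z)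
  (cong₂ _⊕_ (f≈g x) (cong₂ _⊕_ (f≈g y) (f≈g z))))

-- Matrices of affine maps.

basis : Fin n → Vec Bool n
basis zero    = true ∷ 𝟎
basis (suc j) = false ∷ basis j

lookup-basis : (i j : Fin n) → lookup (basis j) i ≡ identity i j
lookup-basis zero    zero    = refl
lookup-basis zero    (suc j) = refl
lookup-basis (suc i) zero    = lookup-replicate i false
lookup-basis (suc i) (suc j) = lookup-basis i j

affineFn-tail : {c : Vec Bool (suc n) → Bool} → AffineFn c → AffineFn (λ x → c (false ∷ x))
affineFn-tail aff x y z = aff (false ∷ x) (false ∷ y) (false ∷ z)

-- Splits `true ∷ x` as `true ∷ 𝟎` plus `false ∷ 𝟎` plus `false ∷ x`. The abstract target covers
-- both scalar functions and vector maps.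
affine-true : {B : Set} {_+_ : B → B → B} {F : Vec Bool (suc n) → B} →
  (∀ x y z → F (x ⊕ y ⊕ z) ≡ F x + (F y + F z)) →
  ∀ x → F (true ∷ x) ≡ F (true ∷ 𝟎) + (F (false ∷ 𝟎) + F (false ∷ x))
affine-true {F = F} aff x =
  trans (cong (λ y → F (true ∷ y)) (sym (trans (⊕-identityˡ _) (⊕-identityˡ x)))) (aff _ _ _)

affineFn-expansion : (c : Vec Bool n → Bool) → AffineFn c → ∀ x →
  c x ≡ sum (λ j → (c (basis j) xor c 𝟎) ∧ lookup x j) xor c 𝟎
affineFn-expansion c aff [] = refl
affineFn-expansion c aff (false ∷ x)
  rewrite ∧-zeroʳ (c (true ∷ 𝟎) xor c (false ∷ 𝟎)) =
  affineFn-expansion (λ y → c (false ∷ y)) (affineFn-tail {c = c} aff) x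
affineFn-expansion c aff (true ∷ x) =
  trans (affine-true {_+_ = _xor_} {c} aff x) (trans
    (cong (λ w → c (true ∷ 𝟎) xor (c (false ∷ 𝟎) xor w))
          (affineFn-expansion (λ y → c (false ∷ y)) (affineFn-tail {c = c} aff) x))
    (solve 3 (λ e o s → e :+ (o :+ (s :+ o)) := (((e :+ o) :* con true) :+ s) :+ o) refl
      (c (true ∷ 𝟎)) (c (false ∷ 𝟎)) (sum (λ j → (c (false ∷ basis j) xor c (false ∷ 𝟎)) ∧ lookup x j))))
  where open xor-∧-Solver

matrix : (Vec Bool n → Vec Bool n) → Matrix n
matrix F i j = lookup (F (basis j)) i xor lookup (F 𝟎) i

matrix-▹ : (F : Vec Bool n → Vec Bool n) → Affine F → ∀ x i →
           lookup (F x) i ≡ (matrix F ▹ lookup x) i xor lookup (F 𝟎) i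
matrix-▹ F aff x i = affineFn-expansion (λ y → lookup (F y) i) (affine⇒coordinates {F = F} aff i) x

-- Column k of `matrix E` is the vector `y`, and applying `matrix F` to it gives F(y) + F(0), which
-- affinity reduces to the k-th basis vector.
matrix-inverse : (F E : Vec Bool n → Vec Bool n) → Affine F → (∀ x → F (E x) ≡ x) →
                 ∀ i k → (matrix F ⊠ matrix E) i k ≡ identity i k
matrix-inverse F E aff FE i k = begin
  sum (λ j → matrix F i j ∧ matrix E j k)
    ≡⟨ sum-cong-≗ (λ j → cong (matrix F i j ∧_) (sym (lookup-zipWith _xor_ j (E (basis k)) (E 𝟎)))) ⟩
  s                                         ≡⟨ solve 2 (λ s o → s := (s :+ o) :+ o) refl s o ⟩
  (s xor o) xor o                           ≡⟨ cong (_xor o) (sym (matrix-▹ F aff y i)) ⟩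
  lookup (F y) i xor o                      ≡⟨ cong (λ w → lookup w i xor o) Fy ⟩
  lookup (basis k ⊕ F 𝟎) i xor o            ≡⟨ cong (_xor o) (lookup-zipWith _xor_ i (basis k) (F 𝟎)) ⟩
  (lookup (basis k) i xor o) xor o          ≡⟨ solve 2 (λ s o → (s :+ o) :+ o := s) refl (lookup (basis k) i) o ⟩
  lookup (basis k) i                        ≡⟨ lookup-basis i k ⟩
  identity i k                              ∎
  where
  open ≡-Reasoning
  open xor-∧-Solver using (solve; _:=_; _:+_)
  y = E (basis k) ⊕ E 𝟎
  o = lookup (F 𝟎) i
  s = sum (λ j → matrix F i j ∧ lookup y j)
  Fy : F y ≡ basis k ⊕ F 𝟎
  Fy = begin
    -- A third summand `𝟎` makes the sum ternary and contributes `F 𝟎`.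
    F (E (basis k) ⊕ E 𝟎)                 ≡⟨ cong (λ w → F (E (basis k) ⊕ w)) (sym (⊕-identityʳ (E 𝟎))) ⟩
    F (E (basis k) ⊕ E 𝟎 ⊕ 𝟎)             ≡⟨ aff _ _ _ ⟩
    F (E (basis k)) ⊕ F (E 𝟎) ⊕ F 𝟎       ≡⟨ cong₂ (λ u v → u ⊕ v ⊕ F 𝟎) (FE (basis k)) (FE 𝟎) ⟩
    basis k ⊕ 𝟎 ⊕ F 𝟎                     ≡⟨ cong (basis k ⊕_) (⊕-identityˡ (F 𝟎)) ⟩
    basis k ⊕ F 𝟎                         ∎

matrix-GL : (F : Perm (Vec Bool n)) → Affine (to F) → GL (matrix (to F))
matrix-GL F aff = matrix (from F) ,
  matrix-inverse (to F) (from F) aff (strictlyInverseˡ F) ,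
  matrix-inverse (from F) (to F) (affine-from F aff) (strictlyInverseʳ F)

▹-affine : (M : Matrix n) (b : Fin n → Bool) (F : Vec Bool n → Vec Bool n) →
           (∀ x i → lookup (F x) i ≡ (M ▹ lookup x) i xor b i) → Affine F
▹-affine M b F eq = coordinates⇒affine λ i → affineFn-ext (λ x → sym (eq x i))
  (affineFn-xor {c = λ x → (M ▹ lookup x) i}
    (affineFn-sum {c = λ j x → M i j ∧ lookup x j} λ j → affineFn-∧ (M i j) (affineFn-unary (λ s → s) j))
    (affineFn-const (b i)))

-- Elementary operations as products of binary instructions.

shear : (Vec Bool n → Bool) → Perm (Vec Bool (suc n))
shear c = mk↔ₛ′ act act involutive involutive
  where
  act : Vec Bool (suc _) → Vec Bool (suc _)
  act (s ∷ x) = (s xor c x) ∷ x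
  involutive : ∀ x → act (act x) ≡ x
  involutive (s ∷ x) = cong (_∷ x)
    (trans (xor-assoc s (c x) (c x)) (trans (cong (s xor_) (xor-same (c x))) (xor-identityʳ s)))

shear-instruction : (c : Vec Bool n → Bool) → IsAry 2 (λ x → head x xor c (tail x)) →
                    IsAryInstruction 2 (shear c)
shear-instruction c (ks , h , eq) = trivial-off⇒instruction (shear c) zero off , ary
  where
  off : ∀ i → i ≢ zero → Trivial (shear c) i
  off zero    0≢0 _       = contradiction refl 0≢0
  off (suc i) _   (s ∷ x) = refl
  ary : ∀ i → IsAry 2 (coord (shear c) i)
  ary zero    = ks , h , λ { x@(_ ∷ _) → eq x }
  ary (suc i) = replicate 2 (suc i) , head , λ { (_ ∷ _) → refl }

-- Affine functions are sums of constants and coordinates: the slope along the first coordinate is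
-- split off, and the rest is affine in the tail.
affineFn-induction : (P : (Vec Bool n → Bool) → Set) →
  (∀ {c d} → (∀ x → c x ≡ d x) → P c → P d) →
  (∀ b → P (λ _ → b)) → (∀ i → P (λ x → lookup x i)) →
  (∀ {c d} → P c → P d → P (λ x → c x xor d x)) →
  ∀ c → AffineFn c → P c
affineFn-induction {zero}  P ext const proj add c aff = ext (λ { [] → refl }) (const (c []))
affineFn-induction {suc n} P ext const proj add c aff =
  ext eq (add (linear slope) (affineFn-induction (λ d → P (d ∘ tail))
    (λ e → ext (e ∘ tail)) const (λ i → ext (λ { (_ ∷ _) → refl }) (proj (suc i))) add
    (λ x → c (false ∷ x)) (affineFn-tail {c = c} aff)))
  where
  slope : Bool
  slope = c (true ∷ 𝟎) xor c (false ∷ 𝟎)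
  linear : ∀ b → P (λ x → lookup x zero ∧ b)
  linear true  = ext (λ x → sym (∧-identityʳ _)) (proj zero)
  linear false = ext (λ x → sym (∧-zeroʳ _)) (const false)
  eq : ∀ x → (lookup x zero ∧ slope) xor c (false ∷ tail x) ≡ c x
  eq (false ∷ x) = refl
  eq (true  ∷ x) = trans (xor-assoc (c (true ∷ 𝟎)) _ _) (sym (affine-true {_+_ = _xor_} {c} aff x))

-- Composing shears adds their functions, which leaves constants and single coordinates; the shears
-- by these read at most two variables.
shear-G : (c : Vec Bool n → Bool) → AffineFn c → G Bool (suc n) 2 (shear c)
shear-G = affineFn-induction (λ c → G Bool _ 2 (shear c))
  (λ e → resp λ { (s ∷ x) → cong (λ t → (s xor t) ∷ x) (e x) })
  (λ b → gen (shear-instruction _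
    (zero ∷ zero ∷ [] , (λ y → head y xor b) , λ { (_ ∷ _) → refl })))
  (λ i → gen (shear-instruction _
    (zero ∷ suc i ∷ [] , (λ y → head y xor head (tail y)) , λ { (_ ∷ _) → refl })))
  (λ {c} {d} Gc Gd → resp (λ { (s ∷ x) → cong (_∷ x)
      (trans (xor-assoc s (d x) (c x)) (cong (s xor_) (xor-comm (d x) (c x)))) }) (mul Gc Gd))

-- The column operation: with a leading 1 as pivot it clears the entries below.
coshear : Vec Bool n → Perm (Vec Bool (suc n))
coshear v = mk↔ₛ′ act act involutive involutive
  where
  act : Vec Bool (suc _) → Vec Bool (suc _)
  act (s ∷ x) = s ∷ (x ⊕ map (s ∧_) v)
  involutive : ∀ x → act (act x) ≡ x
  involutive (s ∷ x) = cong (s ∷_) (⊕-cancelʳ x (map (s ∧_) v))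

⊕-map-∧-𝟎 : ∀ s (x : Vec Bool n) → x ⊕ map (s ∧_) 𝟎 ≡ x
⊕-map-∧-𝟎 s []      = refl
⊕-map-∧-𝟎 s (c ∷ x) = cong₂ _∷_ (trans (cong (c xor_) (∧-zeroʳ s)) (xor-identityʳ c)) (⊕-map-∧-𝟎 s x)

coshear₁-instruction : (b : Bool) → IsAryInstruction 2 (coshear {suc n} (b ∷ 𝟎))
coshear₁-instruction {n} b = trivial-off⇒instruction f (suc zero) off , ary
  where
  f = coshear (b ∷ 𝟎)
  off : ∀ i → i ≢ suc zero → Trivial f i
  off zero          _   (s ∷ t ∷ x) = refl
  off (suc zero)    1≢1 _           = contradiction refl 1≢1
  off (suc (suc i)) _   (s ∷ t ∷ x) = cong (λ y → lookup y i) (⊕-map-∧-𝟎 s x)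
  ary : ∀ i → IsAry 2 (coord f i)
  ary (suc zero) = zero ∷ suc zero ∷ [] , (λ y → head (tail y) xor (head y ∧ b)) , λ { (_ ∷ _ ∷ _) → refl }
  ary zero          = replicate 2 zero , head , off zero λ ()
  ary (suc (suc i)) = replicate 2 (suc (suc i)) , head , off (suc (suc i)) λ ()

-- One binary instruction on the second coordinate treats the entry `b`; the other entries follow by
-- the embedding that skips this coordinate.
coshear-G : (v : Vec Bool n) → G Bool (suc n) 2 (coshear v)
coshear-G []      = resp (λ { (s ∷ []) → refl }) unit
coshear-G (b ∷ v) = resp eq (mul (gen {g = coshear (b ∷ 𝟎)} (coshear₁-instruction b)) (emb-G (suc zero) (coshear-G v)))
  where
  eq : coshear (b ∷ 𝟎) ∙ emb (suc zero) (coshear v) ≈ coshear (b ∷ v)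
  eq (s ∷ t ∷ x) = cong (λ y → s ∷ (t xor (s ∧ b)) ∷ y) (⊕-map-∧-𝟎 s (x ⊕ map (s ∧_) v))

-- Gaussian elimination.

nonzero-entry : (v : Vec Bool n) → v ≢ 𝟎 → ∃[ i ] lookup v i ≡ true
nonzero-entry []          v≢0 = contradiction refl v≢0
nonzero-entry (true  ∷ v) _   = zero , refl
nonzero-entry (false ∷ v) v≢0 with i , vᵢ ← nonzero-entry v (v≢0 ∘ cong (false ∷_)) = suc i , vᵢ

Linear : (Vec Bool n → Vec Bool n) → Set
Linear E = ∀ x y → E (x ⊕ y) ≡ E x ⊕ E y

coshear-linear : (v : Vec Bool n) → Linear (to (coshear v))
coshear-linear v (s ∷ x) (t ∷ y) = cong ((s xor t) ∷_) (rest x y v)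
  where
  rest : ∀ {n} (x y v : Vec Bool n) → (x ⊕ y) ⊕ map ((s xor t) ∧_) v ≡ (x ⊕ map (s ∧_) v) ⊕ (y ⊕ map (t ∧_) v)
  rest []      []      []      = refl
  rest (c ∷ x) (d ∷ y) (b ∷ v) = cong₂ _∷_
    (solve 5 (λ s t b c d → (c :+ d) :+ ((s :+ t) :* b) := (c :+ (s :* b)) :+ (d :+ (t :* b))) refl s t b c d)
    (rest x y v)
    where open xor-∧-Solver

shear-linear : (i : Fin n) → Linear (to (shear (λ x → lookup x i)))
shear-linear i (s ∷ x) (t ∷ y) = cong (_∷ (x ⊕ y)) (trans
  (cong ((s xor t) xor_) (lookup-zipWith _xor_ i x y))
  (solve 4 (λ s t c d → (s :+ t) :+ (c :+ d) := (s :+ c) :+ (t :+ d)) refl s t (lookup x i) (lookup y i)))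
  where open xor-∧-Solver

coshear-clears : (v : Vec Bool n) → to (coshear v) (true ∷ v) ≡ true ∷ 𝟎
coshear-clears v = cong (true ∷_) (trans (cong (v ⊕_) (map-id v)) (⊕-self v))

-- If the leading entry is 0, a shear first adds a nonzero entry to it; then a coshear clears the
-- rest. Linearity is recorded so that `E` can be applied to the slope of an affine map.
pivot : (v : Vec Bool (suc n)) → v ≢ 𝟎 →
        Σ[ E ∈ Perm (Vec Bool (suc n)) ] G Bool (suc n) 2 E × Linear (to E) × to E v ≡ true ∷ 𝟎
pivot (true  ∷ v) _   = coshear v , coshear-G v , coshear-linear v , coshear-clears v
pivot (false ∷ v) v≢0 with i , vᵢ ← nonzero-entry v (v≢0 ∘ cong (false ∷_)) =
  coshear v ∙ shear (λ x → lookup x i) ,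
  mul (coshear-G v) (shear-G _ (affineFn-unary (λ s → s) i)) ,
  (λ x y → trans (cong (to (coshear v)) (shear-linear i x y)) (coshear-linear v _ _)) ,
  trans (cong (λ s → to (coshear v) (s ∷ v)) vᵢ) (coshear-clears v)

slope≢𝟎 : (F : Perm (Vec Bool (suc n))) → to F (true ∷ 𝟎) ⊕ to F 𝟎 ≢ 𝟎
slope≢𝟎 F e with () ← to-injective F (trans (sym (⊕-cancelʳ (to F (true ∷ 𝟎)) (to F 𝟎)))
                                            (trans (cong (_⊕ to F 𝟎) e) (⊕-identityˡ (to F 𝟎))))

-- `E` turns the slope of `F` along the first coordinate into the first basis vector, so the first
-- coordinate enters only the first output, as `s xor c x`. Precomposing with `shear c` removes `c`
-- and leaves an embedded affine permutation of one dimension less.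
affine⊆G2 : ∀ n (F : Perm (Vec Bool n)) → Affine (to F) → G Bool n 2 F
affine⊆G2 zero    F aff = resp unique unit
  where
  unique : ε ≈ F
  unique [] with [] ← to F [] = refl
affine⊆G2 (suc n) F aff
  with E , GE , linear , Ev ← pivot (to F (true ∷ 𝟎) ⊕ to F 𝟎) (slope≢𝟎 F) =
  resp F≈ (mul (inv GE) (mul GF₂ (inv Gc)))
  where
  open ≡-Reasoning
  F₁ F₂ : Perm (Vec Bool (suc n))
  c : Vec Bool n → Bool
  F₁ = E ∙ F
  c x = head (to F₁ (false ∷ x))
  F₂ = F₁ ∙ shear c

  aff₁ : Affine (to F₁)
  aff₁ = affine-∘ {F = to E} (λ x y z → trans (linear x (y ⊕ z)) (cong (to E x ⊕_) (linear y z))) aff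

  F₁-∷ : ∀ s x → to F₁ (s ∷ x) ≡ (s xor c x) ∷ tail (to F₁ (false ∷ x))
  F₁-∷ false x with to F₁ (false ∷ x)
  ... | _ ∷ _ = refl
  F₁-∷ true  x = begin
    to F₁ (true ∷ x)                                          ≡⟨ affine-true {_+_ = _⊕_} {to F₁} aff₁ x ⟩
    to F₁ (true ∷ 𝟎) ⊕ to F₁ 𝟎 ⊕ to F₁ (false ∷ x)            ≡⟨ sym (⊕-assoc (to F₁ (true ∷ 𝟎)) (to F₁ 𝟎) _) ⟩
    (to F₁ (true ∷ 𝟎) ⊕ to F₁ 𝟎) ⊕ to F₁ (false ∷ x)          ≡⟨ cong (_⊕ to F₁ (false ∷ x)) (trans (sym (linear _ _)) Ev) ⟩
    (true ∷ 𝟎) ⊕ to F₁ (false ∷ x)                            ≡⟨ flip (to F₁ (false ∷ x)) ⟩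
    (true xor c x) ∷ tail (to F₁ (false ∷ x))                 ∎
    where
    flip : ∀ y → (true ∷ 𝟎) ⊕ y ≡ (true xor head y) ∷ tail y
    flip (s ∷ y) = cong ((true xor s) ∷_) (⊕-identityˡ y)

  F₂-∷ : ∀ s x → to F₂ (s ∷ x) ≡ s ∷ tail (to F₁ (false ∷ x))
  F₂-∷ s x = trans (F₁-∷ (s xor c x) x) (cong (_∷ tail (to F₁ (false ∷ x)))
    (trans (xor-assoc s (c x) (c x)) (trans (cong (s xor_) (xor-same (c x))) (xor-identityʳ s))))

  g : Σ[ g ∈ Perm (Vec Bool n) ] emb zero g ≈ F₂
  g = restrict F₂ zero false (λ { (s ∷ x) → cong (λ y → lookup y zero) (F₂-∷ s x) })
    λ i x s t → trans (cong (λ y → lookup y (suc i)) (F₂-∷ s x)) (sym (cong (λ y → lookup y (suc i)) (F₂-∷ t x)))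

  g-affine : Affine (to (proj₁ g))
  g-affine x y z = trans (g≗ _) (trans (cong tail (aff₁ (false ∷ x) (false ∷ y) (false ∷ z)))
    (trans (tail-⊕ (to F₁ (false ∷ x)) (to F₁ (false ∷ y)) (to F₁ (false ∷ z)))
           (sym (cong₂ _⊕_ (g≗ x) (cong₂ _⊕_ (g≗ y) (g≗ z))))))
    where
    g≗ : ∀ x → to (proj₁ g) x ≡ tail (to F₁ (false ∷ x))
    g≗ x = cong tail (trans (proj₂ g (false ∷ x)) (F₂-∷ false x))
    tail-⊕ : (x y z : Vec Bool (suc n)) → tail (x ⊕ y ⊕ z) ≡ tail x ⊕ tail y ⊕ tail z
    tail-⊕ (_ ∷ _) (_ ∷ _) (_ ∷ _) = refl

  GF₂ : G Bool (suc n) 2 F₂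
  GF₂ = resp (proj₂ g) (emb-G zero (affine⊆G2 n (proj₁ g) g-affine))

  Gc : G Bool (suc n) 2 (shear c)
  Gc = shear-G c λ x y z → trans (cong head (aff₁ (false ∷ x) (false ∷ y) (false ∷ z)))
                                 (head-⊕ (to F₁ (false ∷ x)) (to F₁ (false ∷ y)) (to F₁ (false ∷ z)))
    where
    head-⊕ : (x y z : Vec Bool (suc n)) → head (x ⊕ y ⊕ z) ≡ head x xor (head y xor head z)
    head-⊕ (_ ∷ _) (_ ∷ _) (_ ∷ _) = refl

  F≈ : E ⁻¹ ∙ (F₂ ∙ shear c ⁻¹) ≈ F
  F≈ x = trans (cong (λ y → from E (to E (to F y))) (strictlyInverseˡ (shear c) x)) (strictlyInverseʳ E (to F x))

-- Transport of the affine description back to `A`.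

G2≐Aff : {A : Set a} (φ : A ↔ Bool) → G A (suc n) 2 ≐ Aff φ (suc n)
G2≐Aff {n = n} {A = A} φ = G⊆Aff , Aff⊆G
  where
  G⊆Aff : G A (suc n) 2 ⊆ Aff φ (suc n)
  G⊆Aff {f} Gf = matrix F , (λ i → lookup (F 𝟎) i) , matrix-GL (relabel φ f) aff , λ x i → begin
    to φ (coord f i x)                                      ≡⟨ cong (to φ ∘ coord f i) (sym (map-from-to φ x)) ⟩
    to φ (coord f i (map (from φ) (map (to φ) x)))          ≡⟨ sym (relabel-coord φ f i (map (to φ) x)) ⟩
    lookup (F (map (to φ) x)) i                             ≡⟨ matrix-▹ F aff (map (to φ) x) i ⟩
    (matrix F ▹ lookup (map (to φ) x)) i xor lookup (F 𝟎) i
      ≡⟨ cong (_xor lookup (F 𝟎) i) (sum-cong-≗ λ j → cong (matrix F i j ∧_) (lookup-map j (to φ) x)) ⟩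
    (matrix F ▹ (λ j → to φ (lookup x j))) i xor lookup (F 𝟎) i ∎
    where
    open ≡-Reasoning
    F = to (relabel φ f)
    aff : Affine F
    aff = G2⊆affine (relabel-G φ Gf)

  Aff⊆G : Aff φ (suc n) ⊆ G A (suc n) 2
  Aff⊆G {f} (M , b , _ , eq) = resp back (relabel-G (↔-sym φ) (affine⊆G2 (suc n) (relabel φ f)
    (▹-affine M b (to (relabel φ f)) λ y i → trans (relabel-coord φ f i y) (trans (eq _ i)
      (cong (_xor b i) (sum-cong-≗ λ j → cong (M i j ∧_)
        (trans (cong (to φ) (lookup-map j (from φ) y)) (strictlyInverseˡ φ (lookup y j)))))))))
    where
    back : relabel (↔-sym φ) (relabel φ f) ≈ f
    back x = trans (map-from-to φ _) (cong (to f) (map-from-to φ x))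

-- Third values, enumeration of a finite set, and assembly of the four statements.

module _ {A : Set a} (_≟_ : DecidableEquality A) (other : HasOther A) where

  -- If the heads agree, another head avoids both vectors. Otherwise the head `x` already avoids the
  -- second vector, and a new second entry avoids the first.
  third-pair : HasThird (Vec A (suc (suc n)))
  third-pair (x ∷ y ∷ r) (x′ ∷ y′ ∷ s) with x ≟ x′
  ... | yes refl = proj₁ (other x) ∷ y ∷ r ,
    proj₂ (other x) ∘ ∷-injectiveˡ , proj₂ (other x) ∘ ∷-injectiveˡ
  ... | no x≢x′  = x ∷ proj₁ (other y) ∷ r ,
    proj₂ (other y) ∘ ∷-injectiveˡ ∘ ∷-injectiveʳ , x≢x′ ∘ ∷-injectiveˡ

third-singleton : HasThird A → HasThird (Vec A 1)
third-singleton third (r ∷ []) (s ∷ []) with t , t≢r , t≢s ← third r s =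
  t ∷ [] , t≢r ∘ ∷-injectiveˡ , t≢s ∘ ∷-injectiveˡ

other-Fin : ∀ {q} → HasOther (Fin (2 + q))
other-Fin zero    = suc zero , λ ()
other-Fin (suc _) = zero , λ ()

third-Fin : ∀ {q} → HasThird (Fin (3 + q))
third-Fin zero          zero          = suc zero , (λ ()) , λ ()
third-Fin zero          (suc zero)    = suc (suc zero) , (λ ()) , λ ()
third-Fin zero          (suc (suc _)) = suc zero , (λ ()) , λ ()
third-Fin (suc zero)    zero          = suc (suc zero) , (λ ()) , λ ()
third-Fin (suc (suc _)) zero          = suc zero , (λ ()) , λ ()
third-Fin (suc _)       (suc _)       = zero , (λ ()) , λ ()

module _ {A : Set a} {q : ℕ} (A↔q : A ↔ Fin q) where

  finite-≟ : DecidableEquality A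
  finite-≟ = via-injection (↔⇒↣ A↔q) _≟ᶠ_

  from≢⇒ : ∀ {i c} → i ≢ to A↔q c → from A↔q i ≢ c
  from≢⇒ i≢ refl = i≢ (sym (strictlyInverseˡ A↔q _))

  elements : List A
  elements = List.map (from A↔q) (List.allFin q)

  elements-full : ∀ c → c ∈ elements
  elements-full c = subst (_∈ elements) (strictlyInverseʳ A↔q c) (∈-map⁺ (from A↔q) (∈-allFin (to A↔q c)))

  elements-unique : Unique elements
  elements-unique = map⁺ from-injective (allFin⁺ q)
    where
    from-injective : ∀ {i j} → from A↔q i ≡ from A↔q j → i ≡ j
    from-injective {i} {j} e =
      trans (sym (strictlyInverseˡ A↔q i)) (trans (cong (to A↔q) e) (strictlyInverseˡ A↔q j))

  length-elements : length elements ≡ q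
  length-elements = trans (length-map (from A↔q) (List.allFin q)) (length-tabulate {n = q} (λ i → i))

theorem2 : ∀ {a} (A : Set a) (q n : ℕ) → A ↔ Fin q → 2 ≤ q → 2 ≤ n →
    (G A n n ≐ U)
    × (q ≡ 2 →
    ((φ : A ↔ Bool) → G A n 2 ≐ Aff φ n)
    × (4 ≤ n → (G A n 3 ≐ G A n (n ∸ 1)) × (G A n (n ∸ 1) ≐ Alt)))
    × (3 ≤ n → 3 ≤ q → ¬ (2 ∣ q) → (G A n 2 ≐ G A n (n ∸ 1)) × (G A n (n ∸ 1) ≐ U))
    × (3 ≤ n → 4 ≤ q → 2 ∣ q → (G A n 2 ≐ G A n (n ∸ 1)) × (G A n (n ∸ 1) ≐ Alt))
theorem2 A q@(suc (suc q′)) (suc m) A↔q (s≤s (s≤s _)) (s≤s (s≤s _)) =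
  ((λ _ → _) , λ {f} _ → G-full _≟_ L full f) ,
  -- For q = 2 a third tail needs length 2, which gives arity 3; for q ≥ 3 length 1 suffices and
  -- gives arity 2.
  (λ { refl → G2≐Aff , λ { (s≤s 3≤m) → alternating 3≤m (third-pair _≟_ other) ∣-refl } }) ,
  (λ { (s≤s 2≤m) 3≤q odd → symmetric 2≤m (third-singleton (third 3≤q)) odd }) ,
  (λ { (s≤s 2≤m) (s≤s 3≤) even → alternating 2≤m (third-singleton (third (s≤s (≤-trans (n≤1+n 2) 3≤)))) even })
  where
  _≟_ : DecidableEquality A
  _≟_ = finite-≟ A↔q
  L : List A
  L = elements A↔q
  full : ∀ c → c ∈ L
  full = elements-full A↔q
  c₀ : A
  c₀ = from A↔q zero
  other : HasOther A
  other c with i , i≢ ← other-Fin (to A↔q c) = from A↔q i , from≢⇒ A↔q i≢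
  third : 3 ≤ q → HasThird A
  third (s≤s (s≤s (s≤s _))) r s with i , i≢r , i≢s ← third-Fin (to A↔q r) (to A↔q s) =
    from A↔q i , from≢⇒ A↔q i≢r , from≢⇒ A↔q i≢s

  -- Three inclusions in a circle yield both equalities.
  alternating : suc l ≤ m → HasThird (Vec A l) → 2 ∣ q →
    (G A (suc m) (suc l) ≐ G A (suc m) m) × (G A (suc m) m ≐ Alt)
  alternating {l} l<m third₁ 2∣q =
    (⊆₁ , λ {f} → ⊆₃ {f} ∘ ⊆₂ {f}) , (λ {f} → ⊆₂ {f}) , λ {f} → ⊆₁ ∘ ⊆₃ {f}
    where
    ⊆₁ : G A (suc m) (suc l) ⊆ G A (suc m) m
    ⊆₁ = G-mono (≤⇒≤′ l<m)
    ⊆₂ : G A (suc m) m ⊆ Alt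
    ⊆₂ {f} = G⊆Alt _≟_ L full (elements-unique A↔q) (subst (2 ∣_) (sym (length-elements A↔q)) 2∣q) other c₀ {f}
    ⊆₃ : Alt ⊆ G A (suc m) (suc l)
    ⊆₃ {f} = Alt⊆G _≟_ c₀ other L full third₁ (≤⇒≤′ (≤-trans (n≤1+n l) l<m)) {f}

  symmetric : suc l ≤ m → HasThird (Vec A l) → ¬ 2 ∣ q →
    (G A (suc m) (suc l) ≐ G A (suc m) m) × (G A (suc m) m ≐ U)
  symmetric {l} l<m third₁ odd = (⊆₁ , λ {f} _ → all f) , (λ _ → _) , λ {f} _ → ⊆₁ (all f)
    where
    ⊆₁ : G A (suc m) (suc l) ⊆ G A (suc m) m
    ⊆₁ = G-mono (≤⇒≤′ l<m)
    all : ∀ f → G A (suc m) (suc l) f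
    all = Sym⊆G _≟_ c₀ other L full third₁ (elements-unique A↔q)
      (odd ∘ subst (2 ∣_) (length-elements A↔q)) (≤⇒≤′ (≤-trans (n≤1+n l) l<m))
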